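{- Let $n\ge 1$ and let $x_1,\dots,x_{2n},y_1,\dots,y_{2n},\lambda$ be indeterminates. Then $$\operatorname{Pf}_\lambda(x_i-y_j)_{1\le i<j\le 2n}=\left(\prod_{k=1}^{n-1}(1-\lambda\sigma_{2k})\right)\left(\prod_{i=1}^n(x_{2i-1}-y_{2i})\right),$$ where the product of the operators $1-\lambda\sigma_{2k}$ (composition) is applied to the polynomial $\prod_{i=1}^n(x_{2i-1}-y_{2i})$, and $\sigma_k$ is the linear and multiplicative operator (i.e. the $\mathbb Z[\lambda]$-algebra endomorphism of $\mathbb Z[\lambda][x_1,\dots,x_{2n},y_1,\dots,y_{2n}]$) with $\sigma_k(x_{k+1})=y_{k+1}$, $\sigma_k(y_k)=x_k$, $\sigma_k(x_i)=x_i$ for $i\ne k+1$, and $\sigma_k(y_i)=y_i$ for $i\ne k$.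
   Context: For an array $(A_{ij})_{1\le i<j\le 2n}$ (the strictly upper triangular part of a skew-symmetric matrix of size $2n$), the $\lambda$-Pfaffian is $$\operatorname{Pf}_\lambda(A_{ij})_{1\le i<j\le 2n}=\sum_{m\in\mathcal M([2n])}(-1)^{\mathrm{cross}(m)}\,\lambda^{\mathrm{cross}(m)+\mathrm{nest}(m)}\prod_{i=1}^n A_{m_{2i-1}m_{2i}}.$$ Here $\mathcal M([2n])$ is the set of perfect matchings of $[2n]=\{1,\dots,2n\}$, written $m=((m_1,m_2),\dots,(m_{2n-1},m_{2n}))$ with $m_{2i-1}<m_{2i}$ for all $i$ and $m_1<m_3<\cdots<m_{2n-1}$. $\mathrm{cross}(m)$ is the number of (unordered) pairs of pairs $(a,b),(c,d)$ in $m$ with $a<c<b<d$; $\mathrm{nest}(m)$ is the number of pairs of pairs $(a,b),(c,d)$ in $m$ with $a<c<d<b$. The operators $\sigma_2,\sigma_4,\dots,\sigma_{2n-2}$ commute pairwise, so the order of composition does not matter; the empty product of operators is the identity. -}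

module Defs where

open import Algebra.Bundles using (CommutativeRing)
open import Algebra.Morphism.Structures using (IsRingHomomorphism)
open import Data.Fin.Base using (Fin; zero; suc; toℕ; combine; _<_)
open import Data.Fin.Properties using (_≟_; _<?_; all?)
open import Data.Integer.Properties using (+-*-commutativeRing)
open import Data.List.Base
  using (List; []; _∷_; map; foldr; filter; length; concatMap; allFin;
         applyUpTo; cartesianProduct; cartesianProductWith)
import Data.List.Membership.DecPropositional as DecMembership
open import Data.List.Membership.Propositional using (_∈_)
import Data.List.Relation.Unary.All as All
open All using (All)
import Data.List.Relation.Unary.Linked as Linked
open Linked using (Linked)
import Data.List.Relation.Unary.Unique.DecPropositional as DecUnique
open import Data.List.Relation.Unary.Unique.Propositional using (Unique)
open import Data.Nat.Base as ℕ using (ℕ; zero; suc; _∸_)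
import Data.Nat.Properties as ℕ
open import Data.Bool.Base using (if_then_else_)
open import Data.Product.Base using (_×_; _,_; proj₁; proj₂; uncurry)
open import Data.Unit.Base using (⊤; tt)
open import Data.Vec.Base as Vec using (Vec; toList; lookup)
open import Function.Base using (id; _∘_)
open import Level using (Level; 0ℓ; _⊔_)
open import Relation.Nullary.Decidable using (Dec; does; _×-dec_)

private
  variable
    a b ℓ₁ ℓ₂ : Level

-- The polynomial ring R[V] is presented as the free commutative R-algebra on
-- V: terms modulo the least congruence containing the commutative ring axioms
-- and making C a ring homomorphism.  Its universal property is given by eval,
-- eval-isRingHomomorphism and eval-unique.
module Polynomial (R : CommutativeRing a ℓ₁) (V : Set) where

  private module R = CommutativeRing R

  infixl 6 _:+_
  infixl 7 _:*_
  infix  8 :-_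
  infix  4 _≋_

  data Poly : Set a where
    C    : R.Carrier → Poly
    X    : V → Poly
    _:+_ : Poly → Poly → Poly
    _:*_ : Poly → Poly → Poly
    :-_  : Poly → Poly

  data _≋_ : Poly → Poly → Set (a ⊔ ℓ₁) where
    ≋-refl  : ∀ {p} → p ≋ p
    ≋-sym   : ∀ {p q} → p ≋ q → q ≋ p
    ≋-trans : ∀ {p q r} → p ≋ q → q ≋ r → p ≋ r

    :+-cong : ∀ {p p′ q q′} → p ≋ p′ → q ≋ q′ → p :+ q ≋ p′ :+ q′
    :*-cong : ∀ {p p′ q q′} → p ≋ p′ → q ≋ q′ → p :* q ≋ p′ :* q′
    :--cong : ∀ {p p′} → p ≋ p′ → :- p ≋ :- p′

    C-cong : ∀ {r s} → r R.≈ s → C r ≋ C s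
    C-+    : ∀ r s → C (r R.+ s) ≋ C r :+ C s
    C-*    : ∀ r s → C (r R.* s) ≋ C r :* C s
    C--    : ∀ r → C (R.- r) ≋ :- C r

    :+-assoc     : ∀ p q r → (p :+ q) :+ r ≋ p :+ (q :+ r)
    :+-comm      : ∀ p q → p :+ q ≋ q :+ p
    :+-identityˡ : ∀ p → C R.0# :+ p ≋ p
    :--inverseˡ  : ∀ p → :- p :+ p ≋ C R.0#
    :*-assoc     : ∀ p q r → (p :* q) :* r ≋ p :* (q :* r)
    :*-comm      : ∀ p q → p :* q ≋ q :* p
    :*-identityˡ : ∀ p → C R.1# :* p ≋ p
    :*-distribˡ  : ∀ p q r → p :* (q :+ r) ≋ p :* q :+ p :* r

  commutativeRing : CommutativeRing a (a ⊔ ℓ₁)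
  commutativeRing = record
    { Carrier = Poly
    ; _≈_ = _≋_
    ; _+_ = _:+_
    ; _*_ = _:*_
    ; -_  = :-_
    ; 0#  = C R.0#
    ; 1#  = C R.1#
    ; isCommutativeRing = record
      { isRing = record
        { +-isAbelianGroup = record
          { isGroup = record
            { isMonoid = record
              { isSemigroup = record
                { isMagma = record
                  { isEquivalence = record
                    { refl = ≋-refl ; sym = ≋-sym ; trans = ≋-trans }
                  ; ∙-cong = :+-cong
                  }
                ; assoc = :+-assoc
                }
              ; identity = :+-identityˡ ,
                  λ p → ≋-trans (:+-comm p _) (:+-identityˡ p)
              }
            ; inverse = :--inverseˡ ,
                λ p → ≋-trans (:+-comm p _) (:--inverseˡ p)
            ; ⁻¹-cong = :--cong
            }
          ; comm = :+-comm
          }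
        ; *-cong = :*-cong
        ; *-assoc = :*-assoc
        ; *-identity = :*-identityˡ ,
            λ p → ≋-trans (:*-comm p _) (:*-identityˡ p)
        ; distrib = :*-distribˡ ,
            λ p q r → ≋-trans (:*-comm (q :+ r) p)
              (≋-trans (:*-distribˡ p q r)
                (:+-cong (:*-comm p q) (:*-comm p r)))
        }
      ; *-comm = :*-comm
      }
    }

  private module P = CommutativeRing commutativeRing

  C-isRingHomomorphism : IsRingHomomorphism R.rawRing P.rawRing C
  C-isRingHomomorphism = record
    { isSemiringHomomorphism = record
      { isNearSemiringHomomorphism = record
        { +-isMonoidHomomorphism = record
          { isMagmaHomomorphism = record
            { isRelHomomorphism = record { cong = C-cong } ; homo = C-+ }
          ; ε-homo = ≋-refl
          }
        ; *-homo = C-*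
        }
      ; 1#-homo = ≋-refl
      }
    ; -‿homo = C--
    }

  module _ (S : CommutativeRing b ℓ₂) where

    private module S = CommutativeRing S

    eval : (R.Carrier → S.Carrier) → (V → S.Carrier) → Poly → S.Carrier
    eval f ρ (C r)    = f r
    eval f ρ (X v)    = ρ v
    eval f ρ (p :+ q) = eval f ρ p S.+ eval f ρ q
    eval f ρ (p :* q) = eval f ρ p S.* eval f ρ q
    eval f ρ (:- p)   = S.- eval f ρ p

    module _ {f : R.Carrier → S.Carrier}
             (f-hom : IsRingHomomorphism R.rawRing S.rawRing f)
             (ρ : V → S.Carrier) where

      private module f = IsRingHomomorphism f-hom

      eval-cong : ∀ {p q} → p ≋ q → eval f ρ p S.≈ eval f ρ q
      eval-cong ≋-refl             = S.refl
      eval-cong (≋-sym e)          = S.sym (eval-cong e)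
      eval-cong (≋-trans e e′)     = S.trans (eval-cong e) (eval-cong e′)
      eval-cong (:+-cong e e′)     = S.+-cong (eval-cong e) (eval-cong e′)
      eval-cong (:*-cong e e′)     = S.*-cong (eval-cong e) (eval-cong e′)
      eval-cong (:--cong e)        = S.-‿cong (eval-cong e)
      eval-cong (C-cong e)         = f.⟦⟧-cong e
      eval-cong (C-+ r s)          = f.+-homo r s
      eval-cong (C-* r s)          = f.*-homo r s
      eval-cong (C-- r)            = f.-‿homo r
      eval-cong (:+-assoc _ _ _)   = S.+-assoc _ _ _
      eval-cong (:+-comm _ _)      = S.+-comm _ _
      eval-cong (:+-identityˡ _)   = S.trans (S.+-congʳ f.0#-homo) (S.+-identityˡ _)
      eval-cong (:--inverseˡ _)    = S.trans (S.-‿inverseˡ _) (S.sym f.0#-homo)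
      eval-cong (:*-assoc _ _ _)   = S.*-assoc _ _ _
      eval-cong (:*-comm _ _)      = S.*-comm _ _
      eval-cong (:*-identityˡ _)   = S.trans (S.*-congʳ f.1#-homo) (S.*-identityˡ _)
      eval-cong (:*-distribˡ _ _ _) = S.distribˡ _ _ _

      eval-isRingHomomorphism :
        IsRingHomomorphism P.rawRing S.rawRing (eval f ρ)
      eval-isRingHomomorphism = record
        { isSemiringHomomorphism = record
          { isNearSemiringHomomorphism = record
            { +-isMonoidHomomorphism = record
              { isMagmaHomomorphism = record
                { isRelHomomorphism = record { cong = eval-cong }
                ; homo = λ _ _ → S.refl
                }
              ; ε-homo = f.0#-homo
              }
            ; *-homo = λ _ _ → S.refl
            }
          ; 1#-homo = f.1#-homo
          }
        ; -‿homo = λ _ → S.refl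
        }

      eval-unique : ∀ {g} → IsRingHomomorphism P.rawRing S.rawRing g →
        (∀ r → g (C r) S.≈ f r) → (∀ v → g (X v) S.≈ ρ v) →
        ∀ p → g p S.≈ eval f ρ p
      eval-unique {g} g-hom gC gX = go
        where
        module g = IsRingHomomorphism g-hom
        go : ∀ p → g p S.≈ eval f ρ p
        go (C r)    = gC r
        go (X v)    = gX v
        go (p :+ q) = S.trans (g.+-homo p q) (S.+-cong (go p) (go q))
        go (p :* q) = S.trans (g.*-homo p q) (S.*-cong (go p) (go q))
        go (:- p)   = S.trans (g.-‿homo p) (S.-‿cong (go p))

-- [2n] is Fin (n * 2), with i : Fin m standing for the number index i.
index : ∀ {m} → Fin m → ℕ
index i = suc (toℕ i)

-- For index i = k these are the elements 2k-1 and 2k of [2n].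
odd even : ∀ {n} → Fin n → Fin (n ℕ.* 2)
odd  i = combine i zero
even i = combine i (suc zero)

Pair : ℕ → Set
Pair s = Fin s × Fin s

entries : ∀ {s k} → Vec (Pair s) k → List (Fin s)
entries m = concatMap (λ (i , j) → i ∷ j ∷ []) (toList m)

-- Every element of [2n] lies in exactly one pair, the two entries of each pair
-- increase, and so do the first entries of successive pairs.
IsPerfectMatching : ∀ {n} → Vec (Pair (n ℕ.* 2)) n → Set
IsPerfectMatching m =
  Unique (entries m) ×
  (∀ i → i ∈ entries m) ×
  All (uncurry _<_) (toList m) ×
  Linked _<_ (map proj₁ (toList m))

isPerfectMatching? : ∀ {n} (m : Vec (Pair (n ℕ.* 2)) n) → Dec (IsPerfectMatching m)
isPerfectMatching? m =
  DecUnique.unique? _≟_ (entries m) ×-dec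
  all? (λ i → DecMembership._∈?_ _≟_ i (entries m)) ×-dec
  All.all? (λ (i , j) → i <? j) (toList m) ×-dec
  Linked.linked? _<?_ (map proj₁ (toList m))

vectors : ∀ {A : Set} → List A → (k : ℕ) → List (Vec A k)
vectors as zero    = Vec.[] ∷ []
vectors as (suc k) = cartesianProductWith Vec._∷_ as (vectors as k)

perfectMatchings : ∀ n → List (Vec (Pair (n ℕ.* 2)) n)
perfectMatchings n =
  filter isPerfectMatching?
    (vectors (cartesianProduct (allFin (n ℕ.* 2)) (allFin (n ℕ.* 2))) n)

Crossing Nesting : ∀ {s} → Pair s × Pair s → Set
Crossing ((a , b) , (c , d)) = a < c × c < b × b < d
Nesting  ((a , b) , (c , d)) = a < c × c < d × d < b

crossing? : ∀ {s} (pq : Pair s × Pair s) → Dec (Crossing pq)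
crossing? ((a , b) , (c , d)) = a <? c ×-dec c <? b ×-dec b <? d

nesting? : ∀ {s} (pq : Pair s × Pair s) → Dec (Nesting pq)
nesting? ((a , b) , (c , d)) = a <? c ×-dec c <? d ×-dec d <? b

-- Counting ordered pairs of pairs is enough: a < c admits at most one of the
-- two orders of an unordered one.
cross nest : ∀ {s k} → Vec (Pair s) k → ℕ
cross m = length (filter crossing? (cartesianProduct (toList m) (toList m)))
nest  m = length (filter nesting? (cartesianProduct (toList m) (toList m)))

module _ (R : CommutativeRing a ℓ₁) where

  open CommutativeRing R
  open import Algebra.Properties.Semiring.Exp semiring using (_^_)
  import Algebra.Properties.CommutativeMonoid.Sum *-commutativeMonoid as Product

  ∏ : ∀ {n} → (Fin n → Carrier) → Carrier
  ∏ = Product.sum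

  summand : Carrier → ∀ {n} → (Fin (n ℕ.* 2) → Fin (n ℕ.* 2) → Carrier) →
    Vec (Pair (n ℕ.* 2)) n → Carrier
  summand l A m =
    (- 1#) ^ cross m * l ^ (cross m ℕ.+ nest m) * ∏ (λ i → uncurry A (lookup m i))

  -- Only the entries A i j with i < j are used.
  Pf : Carrier → ∀ n → (Fin (n ℕ.* 2) → Fin (n ℕ.* 2) → Carrier) → Carrier
  Pf l n A = foldr _+_ 0# (map (summand l A) (perfectMatchings n))

data Var (m : ℕ) : Set where
  ‵x ‵y : Fin m → Var m

module ℤ[λ] = Polynomial +-*-commutativeRing ⊤

ℤ[λ]-ring : CommutativeRing 0ℓ 0ℓ
ℤ[λ]-ring = ℤ[λ].commutativeRing

module ℤ[λ][x,y] (n : ℕ) where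

  open Polynomial ℤ[λ]-ring (Var (n ℕ.* 2)) public

  open CommutativeRing commutativeRing public using (_≈_; _*_; _-_)

  ƛ : Poly
  ƛ = C (ℤ[λ].X tt)

  x y : Fin (n ℕ.* 2) → Poly
  x i = X (‵x i)
  y i = X (‵y i)

  σ-var : ℕ → Var (n ℕ.* 2) → Poly
  σ-var k (‵x i) = if does (index i ℕ.≟ suc k) then y i else x i
  σ-var k (‵y i) = if does (index i ℕ.≟ k)     then x i else y i

  σ : ℕ → Poly → Poly
  σ k = eval commutativeRing C (σ-var k)

  1-ƛσ : ℕ → Poly → Poly
  1-ƛσ k p = p - ƛ * σ k p

  -- The composite of 1 - λσ₂ₖ for k = 1, …, n - 1.
  ∏[1-ƛσ] : Poly → Poly
  ∏[1-ƛσ] = foldr _∘_ id (map (λ k → 1-ƛσ (2 ℕ.* k)) (applyUpTo suc (n ∸ 1)))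

{-# OPTIONS --safe #-}
module Submission where

-- Scan the positions from right to left, keeping the list L of closers still
-- waiting for an opener.  When the opener p is joined to b ∈ L, the
-- crossings and nestings it forms with the arcs whose opener lies further left
-- and whose closer is already in L number |L| - 1, and the crossings among
-- them are the elements of L below b.  So Pf_λ is a sum over scans in which
-- joining p to b costs (-1)^#{c ∈ L | c < b} λ^(|L| - 1) A p b.
--
-- For A p b = x p - y b the scans starting from L contribute an alternating
-- function of L which, as A has rank two, factors through the exterior algebra
-- of a two-dimensional space: it is s for L = [], α - β y_b for L = [b],
-- γ (y_b - y_c) for L = [b , c] and 0 for longer L.  Two consecutive
-- positions act on (s , γ) by a 2 × 2 matrix, and the same matrices arise
-- from expanding the operators 1 - λσ₂ₖ one block at a time.

open import Defs
open import Algebra.Bundles using (CommutativeMonoid; CommutativeRing)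
import Algebra.Morphism.Construct.Composition as Composition
open import Algebra.Morphism.Structures using (IsRingHomomorphism)
import Algebra.Properties.CommutativeSemigroup
import Algebra.Solver.Ring
open import Algebra.Solver.Ring.AlmostCommutativeRing
  using (fromCommutativeRing; _-Raw-AlmostCommutative⟶_)
open import Data.Bool.Base using (true; false)
open import Data.Empty using (⊥-elim)
open import Data.Fin.Base using (Fin; zero; suc; toℕ; fromℕ<; _<_)
import Data.Fin.Properties as Fin
import Data.Integer.Properties as ℤ
open import Data.List.Base
  using (List; []; _∷_; _++_; _∷ʳ_; map; foldr; filter; length; concatMap;
         allFin; applyUpTo; initLast; _∷ʳ′_; cartesianProduct)
import Data.List.Properties as List
open import Data.List.Membership.Propositional using (_∈_; find; lose)
open import Data.List.Membership.Propositional.Properties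
open import Data.List.Membership.Propositional.Properties.WithK using (unique∧set⇒bag)
open import Data.List.Relation.Binary.BagAndSetEquality using (∼bag⇒↭)
open import Data.List.Relation.Binary.Disjoint.Propositional using (Disjoint)
open import Data.List.Relation.Binary.Permutation.Propositional as Perm
  using (_↭_; ↭-refl; ↭-sym; ↭-trans; prep; swap; ↭⇒↭ₛ)
open import Data.List.Relation.Binary.Permutation.Propositional.Properties
  using (∈-resp-↭; All-resp-↭; ↭-length; shift; map⁺; ++⁺ʳ; ++⁺ˡ)
import Data.List.Relation.Binary.Permutation.Setoid.Properties as Permutationₛ
open import Data.List.Relation.Unary.All as All using (All; []; _∷_)
import Data.List.Relation.Unary.All.Properties as All
open import Data.List.Relation.Unary.AllPairs as AllPairs using (AllPairs; []; _∷_)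
import Data.List.Relation.Unary.AllPairs.Properties as AllPairs
open import Data.List.Relation.Unary.Any using (here; there)
open import Data.List.Relation.Unary.Linked using (Linked)
import Data.List.Relation.Unary.Linked.Properties as Linked
open import Data.List.Relation.Unary.Unique.Propositional using (Unique)
import Data.List.Relation.Unary.Unique.Propositional.Properties as Unique
open import Data.Maybe.Base using (Maybe; just; nothing)
open import Data.Nat.Base as ℕ using (ℕ; zero; suc; _≤_)
open import Data.Nat.ListAction using (sum)
open import Data.Nat.ListAction.Properties using (sum-↭)
import Data.Nat.Properties as ℕ
open import Data.Nat.Solver using (module +-*-Solver)
open import Data.Product.Base
  using (_×_; _,_; proj₁; proj₂; uncurry; map₂; ∃; ∃₂)
open import Data.Sum.Base using (_⊎_; inj₁; inj₂; [_,_]′)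
open import Data.Vec.Base as Vec using (Vec; toList; fromList; lookup)
import Data.Vec.Properties as Vec
open import Function.Base using (_∘_; id; case_of_)
open import Function.Bundles using (mk⇔)
open import Level using (Level; 0ℓ)
open import Relation.Binary.Core using (Rel)
open import Relation.Binary.Definitions using (tri<; tri≈; tri>)
open import Relation.Binary.PropositionalEquality as ≡ using (_≡_; _≢_)
open import Relation.Nullary.Decidable
  using (Dec; yes; no; does; dec-true; dec-false; _×-dec_)
open import Relation.Nullary.Negation using (¬_; contradiction)
open import Relation.Unary using (Pred; Decidable)

-- Lists: permutations, distinct entries, removal of one element

private
  variable
    a ℓ : Level
    A B : Set

unique∧set⇒↭ : {xs ys : List A} → Unique xs → Unique ys →
  (∀ {z} → z ∈ xs → z ∈ ys) → (∀ {z} → z ∈ ys → z ∈ xs) → xs ↭ ys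
unique∧set⇒↭ xs! ys! xs⊆ys ys⊆xs = ∼bag⇒↭ (unique∧set⇒bag xs! ys! (mk⇔ xs⊆ys ys⊆xs))

Unique-resp-↭ : {xs ys : List A} → xs ↭ ys → Unique xs → Unique ys
Unique-resp-↭ xs↭ys = Permutationₛ.Unique-resp-↭ (≡.setoid _) (↭⇒↭ₛ xs↭ys)

Unique-++⇒disjoint : {x : A} (xs : List A) {ys : List A} →
  Unique (xs ++ ys) → x ∈ xs → ¬ x ∈ ys
Unique-++⇒disjoint (x ∷ xs) (x∉ ∷ _) (here ≡.refl) x∈ys =
  All.lookup x∉ (∈-++⁺ʳ xs x∈ys) ≡.refl
Unique-++⇒disjoint (_ ∷ xs) (_ ∷ !) (there x∈xs) x∈ys =
  Unique-++⇒disjoint xs ! x∈xs x∈ys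

AllPairs-++⇒All : {_∼_ : Rel A 0ℓ} (xs : List A) {y : A} {ys : List A} →
  AllPairs _∼_ (xs ++ y ∷ ys) → All (_∼ y) xs
AllPairs-++⇒All []       _        = []
AllPairs-++⇒All (x ∷ xs) (x∼ ∷ ∼s) =
  All.lookup x∼ (∈-++⁺ʳ xs (here ≡.refl)) ∷ AllPairs-++⇒All xs ∼s

AllPairs-++⇒ʳ : {_∼_ : Rel A 0ℓ} (xs : List A) {ys : List A} →
  AllPairs _∼_ (xs ++ ys) → AllPairs _∼_ ys
AllPairs-++⇒ʳ []       ∼s       = ∼s
AllPairs-++⇒ʳ (_ ∷ xs) (_ ∷ ∼s) = AllPairs-++⇒ʳ xs ∼s

removals : List A → List (A × List A)
removals []      = []
removals (b ∷ L) = (b , L) ∷ map (map₂ (b ∷_)) (removals L)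

removals-↭ : ∀ (L : List A) {b L′} → (b , L′) ∈ removals L → L ↭ b ∷ L′
removals-↭ (c ∷ L) (here ≡.refl) = ↭-refl
removals-↭ (c ∷ L) (there r) with _ , r′ , ≡.refl ← ∈-map⁻ _ r =
  ↭-trans (prep c (removals-↭ L r′)) (swap c _ ↭-refl)

removals-AllPairs : ∀ {_∼_ : Rel A 0ℓ} (L : List A) {b L′} → AllPairs _∼_ L →
  (b , L′) ∈ removals L → AllPairs _∼_ L′
removals-AllPairs (c ∷ L) (_ ∷ ∼s) (here ≡.refl) = ∼s
removals-AllPairs (c ∷ L) (c∼ ∷ ∼s) (there r) with _ , r′ , ≡.refl ← ∈-map⁻ _ r =
  All.tail (All-resp-↭ (removals-↭ L r′) c∼) ∷ removals-AllPairs L ∼s r′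

∈⇒∈-removals : ∀ {b : A} {L} → b ∈ L → ∃ λ L′ → (b , L′) ∈ removals L
∈⇒∈-removals (here ≡.refl) = _ , here ≡.refl
∈⇒∈-removals (there b∈L) with L′ , r ← ∈⇒∈-removals b∈L = _ , there (∈-map⁺ _ r)

map-proj₁-removals : ∀ (L : List A) → map proj₁ (removals L) ≡ L
map-proj₁-removals []      = ≡.refl
map-proj₁-removals (b ∷ L) = ≡.cong (b ∷_)
  (≡.trans (≡.sym (List.map-∘ (removals L))) (map-proj₁-removals L))

-- Perfect matchings as results of right-to-left scans

pairEntries : ∀ {N} → List (Pair N) → List (Fin N)
pairEntries = concatMap (λ (i , j) → i ∷ j ∷ [])

length-pairEntries : ∀ {N} (m : List (Pair N)) → length (pairEntries m) ≡ length m ℕ.* 2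
length-pairEntries []      = ≡.refl
length-pairEntries (_ ∷ m) = ≡.cong (2 ℕ.+_) (length-pairEntries m)

module _ {N : ℕ} where

  -- The positions still to be scanned, in scanning order. The bound is irrelevant, so different
  -- proofs of it give the same list definitionally.
  below : ∀ j → .(j ℕ.≤ N) → List (Fin N)
  below zero    _   = []
  below (suc j) j<N = fromℕ< j<N ∷ below j (ℕ.<⇒≤ j<N)

  below-< : ∀ j .(j≤N : j ℕ.≤ N) → All (λ i → toℕ i ℕ.< j) (below j j≤N)
  below-< zero    _   = []
  below-< (suc j) j<N = ℕ.≤-reflexive (≡.cong suc (Fin.toℕ-fromℕ< j<N)) ∷
    All.map ℕ.m<n⇒m<1+n (below-< j (ℕ.<⇒≤ j<N))

  below-unique : ∀ j .(j≤N : j ℕ.≤ N) → Unique (below j j≤N)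
  below-unique zero    _   = []
  below-unique (suc j) j<N =
    All.map (λ i<j p≡i → ℕ.<-irrefl (≡.trans (≡.cong toℕ (≡.sym p≡i)) (Fin.toℕ-fromℕ< j<N)) i<j)
      (below-< j (ℕ.<⇒≤ j<N)) ∷ below-unique j (ℕ.<⇒≤ j<N)

  ∈-below : ∀ j .(j≤N : j ℕ.≤ N) {i} → toℕ i ℕ.< j → i ∈ below j j≤N
  ∈-below (suc j) j<N {i} i<1+j with toℕ i ℕ.≟ j
  ... | yes ≡.refl = here (≡.sym (Fin.fromℕ<-toℕ i j<N))
  ... | no i≢j     = there (∈-below j (ℕ.<⇒≤ j<N) (ℕ.≤∧≢⇒< (ℕ.s≤s⁻¹ i<1+j) i≢j))

  below-↭ : below N ℕ.≤-refl ↭ allFin N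
  below-↭ = unique∧set⇒↭ (below-unique N ℕ.≤-refl) (Unique.allFin⁺ N)
    (λ {i} _ → ∈-allFin i) (λ {i} _ → ∈-below N ℕ.≤-refl (Fin.toℕ<n i))

  -- The arcs in m have their openers at positions ≥ j, and L lists the closers
  -- at positions ≥ j whose openers lie below j.
  extensions : ∀ j → .(j ℕ.≤ N) → List (Fin N) → List (Pair N) → List (List (Pair N))
  extensions zero    _   []      m = m ∷ []
  extensions zero    _   (_ ∷ _) m = []
  extensions (suc j) j<N L       m =
    extensions j (ℕ.<⇒≤ j<N) (p ∷ L) m ++
    concatMap (λ (b , L′) → extensions j (ℕ.<⇒≤ j<N) L′ ((p , b) ∷ m)) (removals L)
    where p = fromℕ< j<N

  -- Invariant of a scan. The lower bounds put the next position to the left of everything recorded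
  -- so far; `ascending` later turns ranks in `L` into signs.
  record Partial (j : ℕ) .(j≤N : j ℕ.≤ N) (L : List (Fin N)) (m : List (Pair N)) : Set where
    field
      partition  : (pairEntries m ++ L) ++ below j j≤N ↭ allFin N
      ascending  : AllPairs _<_ L
      pending≥   : All (λ b → j ℕ.≤ toℕ b) L
      starts≥    : All (λ q → j ℕ.≤ toℕ (proj₁ q)) m
      increasing : All (uncurry _<_) m
      sorted     : AllPairs _<_ (map proj₁ m)

  initial : Partial N ℕ.≤-refl [] []
  initial = record
    { partition  = below-↭
    ; ascending  = []
    ; pending≥   = []
    ; starts≥    = []
    ; increasing = []
    ; sorted     = []
    }

  module _ {j : ℕ} .{j<N : suc j ℕ.≤ N} {L : List (Fin N)} {m : List (Pair N)}
           (P : Partial (suc j) j<N L m) where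

    open Partial P

    private
      p = fromℕ< j<N
      p≡j = Fin.toℕ-fromℕ< j<N

      p<_ : {i : Fin N} → suc j ℕ.≤ toℕ i → p < i
      p<_ j<i = ℕ.≤-trans (ℕ.≤-reflexive (≡.cong suc p≡j)) j<i

    p<pending : All (p <_) L
    p<pending = All.map p<_ pending≥

    p<starts : All (λ q → p < proj₁ q) m
    p<starts = All.map p<_ starts≥

    push : Partial j (ℕ.<⇒≤ j<N) (p ∷ L) m
    push = record
      { partition  = ↭-trans (++⁺ʳ (below j _) (shift p (pairEntries m) L))
          (↭-trans (↭-sym (shift p (pairEntries m ++ L) (below j _))) partition)
      ; ascending  = p<pending ∷ ascending
      ; pending≥   = ℕ.≤-reflexive (≡.sym p≡j) ∷ All.map ℕ.<⇒≤ pending≥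
      ; starts≥    = All.map ℕ.<⇒≤ starts≥
      ; increasing = increasing
      ; sorted     = sorted
      }

    join : ∀ {b L′} → (b , L′) ∈ removals L → Partial j (ℕ.<⇒≤ j<N) L′ ((p , b) ∷ m)
    join {b} {L′} r = record
      { partition  = ↭-trans
          (prep p (++⁺ʳ (below j _) (↭-trans (↭-sym (shift b (pairEntries m) L′))
            (++⁺ˡ (pairEntries m) (↭-sym L↭)))))
          (↭-trans (↭-sym (shift p (pairEntries m ++ L) (below j _))) partition)
      ; ascending  = removals-AllPairs L ascending r
      ; pending≥   = All.map ℕ.<⇒≤ (All.tail (All-resp-↭ L↭ pending≥))
      ; starts≥    = ℕ.≤-reflexive (≡.sym p≡j) ∷ All.map ℕ.<⇒≤ starts≥
      ; increasing = All.head (All-resp-↭ L↭ p<pending) ∷ increasing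
      ; sorted     = All.map⁺ p<starts ∷ sorted
      }
      where L↭ = removals-↭ L r

  extensions-suc⁻ : ∀ j .{j<N : suc j ℕ.≤ N} L {m m*} (let p = fromℕ< j<N) →
    m* ∈ extensions (suc j) j<N L m →
    m* ∈ extensions j (ℕ.<⇒≤ j<N) (p ∷ L) m ⊎
    ∃₂ λ b L′ → (b , L′) ∈ removals L × m* ∈ extensions j (ℕ.<⇒≤ j<N) L′ ((p , b) ∷ m)
  extensions-suc⁻ j {j<N} L m*∈
    with ∈-++⁻ (extensions j (ℕ.<⇒≤ j<N) (fromℕ< j<N ∷ L) _) m*∈
  ... | inj₁ m*∈ˡ = inj₁ m*∈ˡ
  ... | inj₂ m*∈ʳ with _ , r , m*∈′ ← find (∈-concatMap⁻ _ {removals L} m*∈ʳ) =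
    inj₂ (_ , _ , r , m*∈′)

  extensions-sound : ∀ j .{j≤N : j ℕ.≤ N} {L m m*} → Partial j j≤N L m →
    m* ∈ extensions j j≤N L m → Partial 0 ℕ.z≤n [] m*
  extensions-sound zero    {L = []} P (here ≡.refl) = P
  extensions-sound (suc j) {j<N} {L} P m*∈ with extensions-suc⁻ j {j<N} L m*∈
  ... | inj₁ m*∈′             = extensions-sound j (push P) m*∈′
  ... | inj₂ (_ , _ , r , m*∈′) = extensions-sound j (join P r) m*∈′

  ⊆-extensions : ∀ j .{j≤N : j ℕ.≤ N} {L m m* q} →
    m* ∈ extensions j j≤N L m → q ∈ m → q ∈ m*
  ⊆-extensions zero    {L = []} (here ≡.refl) q∈m = q∈m
  ⊆-extensions (suc j) {j<N} {L} m*∈ q∈m with extensions-suc⁻ j {j<N} L m*∈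
  ... | inj₁ m*∈′             = ⊆-extensions j m*∈′ q∈m
  ... | inj₂ (_ , _ , _ , m*∈′) = ⊆-extensions j m*∈′ (there q∈m)

  -- Later moves only open arcs further left. Together with `⊆-extensions` this lets a finished
  -- matching reveal which move was made at each position.
  extensions-starts : ∀ j .{j≤N : j ℕ.≤ N} {L m m* q} →
    m* ∈ extensions j j≤N L m → q ∈ m* → toℕ (proj₁ q) ℕ.< j ⊎ q ∈ m
  extensions-starts zero    {L = []} (here ≡.refl) q∈m* = inj₂ q∈m*
  extensions-starts (suc j) {j<N} {L} m*∈ q∈m* with extensions-suc⁻ j {j<N} L m*∈
  ... | inj₁ m*∈′ with extensions-starts j m*∈′ q∈m*
  ...   | inj₁ q<j = inj₁ (ℕ.m<n⇒m<1+n q<j)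
  ...   | inj₂ q∈m = inj₂ q∈m
  extensions-starts (suc j) {j<N} {L} m*∈ q∈m* | inj₂ (_ , _ , _ , m*∈′)
    with extensions-starts j m*∈′ q∈m*
  ... | inj₁ q<j             = inj₁ (ℕ.m<n⇒m<1+n q<j)
  ... | inj₂ (here ≡.refl)   = inj₁ (ℕ.≤-reflexive (≡.cong suc (Fin.toℕ-fromℕ< j<N)))
  ... | inj₂ (there q∈m)     = inj₂ q∈m

  Partial-unique : ∀ {j} .{j≤N : j ℕ.≤ N} {L m} → Partial j j≤N L m →
    Unique ((pairEntries m ++ L) ++ below j j≤N)
  Partial-unique P = Unique-resp-↭ (↭-sym (Partial.partition P)) (Unique.allFin⁺ N)

  -- The branches at `p` are disjoint: after a push no arc opens at `p`, and after joining `p` to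
  -- `b` the only arc opening at `p` is `(p , b)`.
  extensions-unique : ∀ j .{j≤N : j ℕ.≤ N} {L m} → Partial j j≤N L m →
    Unique (extensions j j≤N L m)
  extensions-unique zero    {L = []}    P = [] ∷ []
  extensions-unique zero    {L = _ ∷ _} P = []
  extensions-unique (suc j) {j<N} {L} {m} P = Unique.++⁺
    (extensions-unique j (push P))
    (Unique.concat⁺
      (All.map⁺ (All.tabulate (λ r → extensions-unique j (join P r))))
      (AllPairs.map⁺ (AllPairs.map disjoint distinct)))
    λ (m*∈ˡ , m*∈ʳ) →
      let _ , _ , m*∈′ = find (∈-concatMap⁻ _ {removals L} m*∈ʳ)
      in case extensions-starts j m*∈ˡ (⊆-extensions j m*∈′ (here ≡.refl)) of λ where
        (inj₁ p<j) → p≮j p<j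
        (inj₂ p∈m) → p∉m p∈m
    where
    p = fromℕ< j<N

    p≮j : ¬ toℕ p ℕ.< j
    p≮j p<j = ℕ.<-irrefl (Fin.toℕ-fromℕ< j<N) p<j

    p∉m : ∀ {b} → ¬ (p , b) ∈ m
    p∉m p∈m = ℕ.<-irrefl ≡.refl (All.lookup (p<starts P) p∈m)

    disjoint : ∀ {r r′ : Fin N × List (Fin N)} → proj₁ r ≢ proj₁ r′ →
      Disjoint (extensions j (ℕ.<⇒≤ j<N) (proj₂ r) ((p , proj₁ r) ∷ m))
               (extensions j (ℕ.<⇒≤ j<N) (proj₂ r′) ((p , proj₁ r′) ∷ m))
    disjoint b≢b′ (m*∈ , m*∈′)
      with extensions-starts j m*∈′ (⊆-extensions j m*∈ (here ≡.refl))
    ... | inj₁ p<j           = p≮j p<j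
    ... | inj₂ (here eq)     = b≢b′ (≡.cong proj₂ eq)
    ... | inj₂ (there p∈m)   = p∉m p∈m

    distinct : AllPairs (λ r r′ → proj₁ r ≢ proj₁ r′) (removals L)
    distinct = AllPairs.map⁻ (≡.subst Unique (≡.sym (map-proj₁-removals L))
      (AllPairs.map Fin.<⇒≢ (Partial.ascending P)))

  -- `IsPerfectMatching` freed from the length index, since the number of arcs of a scan is known
  -- only at its end.
  IsMatching : List (Pair N) → Set
  IsMatching m =
    Unique (pairEntries m) ×
    (∀ i → i ∈ pairEntries m) ×
    All (uncurry _<_) m ×
    Linked _<_ (map proj₁ m)

  entries-↭ : ∀ {m} → Partial 0 ℕ.z≤n [] m → pairEntries m ↭ allFin N
  entries-↭ P = ≡.subst (_↭ allFin N)
    (≡.trans (List.++-identityʳ _) (List.++-identityʳ _)) (Partial.partition P)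

  complete⇒IsMatching : ∀ {m} → Partial 0 ℕ.z≤n [] m → IsMatching m
  complete⇒IsMatching P =
    Unique-resp-↭ (↭-sym (entries-↭ P)) (Unique.allFin⁺ N) ,
    (λ i → ∈-resp-↭ (↭-sym (entries-↭ P)) (∈-allFin i)) ,
    Partial.increasing P ,
    Linked.AllPairs⇒Linked (Partial.sorted P)

  complete⇒length : ∀ {m} → Partial 0 ℕ.z≤n [] m → length m ℕ.* 2 ≡ N
  complete⇒length {m} P = begin
    length m ℕ.* 2          ≡⟨ length-pairEntries m ⟨
    length (pairEntries m)  ≡⟨ ↭-length (entries-↭ P) ⟩
    length (allFin N)       ≡⟨ List.length-tabulate id ⟩
    N                       ∎
    where open ≡.≡-Reasoning

  -- The matching itself dictates the moves. As it is sorted by openers, the last arc of `m′` is the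
  -- next one the scan can open: if it opens at `p` the move is a join, otherwise a push.
  extensions-complete : ∀ j .{j≤N : j ℕ.≤ N} {L m} m′ {m*} → Partial j j≤N L m →
    IsMatching m* → m* ≡ m′ ++ m → All (λ q → toℕ (proj₁ q) ℕ.< j) m′ →
    m* ∈ extensions j j≤N L m
  extensions-complete zero {L = []} [] P M ≡.refl m′< = here ≡.refl
  -- A closer cannot be left over: `m` now covers every position, whereas the partition keeps `b`
  -- apart from the entries of `m`.
  extensions-complete zero {L = b ∷ L} {m} [] P (_ , all∈ , _) ≡.refl m′< = ⊥-elim
    (Unique-++⇒disjoint (pairEntries m)
      (≡.subst Unique (List.++-identityʳ _) (Partial-unique P)) (all∈ b) (here ≡.refl))
  extensions-complete zero (_ ∷ _) P M m*≡ (() ∷ _)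
  extensions-complete (suc j) {j<N} {L} {m} m′ P M m*≡ m′< with initLast m′
  ... | [] = ∈-++⁺ˡ (extensions-complete j [] (push P) M m*≡ [])
  ... | m″ ∷ʳ′ (a , b) = last (a Fin.≟ p)
    where
    p = fromℕ< j<N
    m*≡′ = ≡.trans m*≡ (List.∷ʳ-++ m″ (a , b) m)
    M′ = ≡.subst IsMatching m*≡′ M

    a≤j : toℕ a ℕ.≤ j
    a≤j = ℕ.s≤s⁻¹ (All.head (All.++⁻ʳ m″ m′<))

    m″<a : All (λ q → proj₁ q < a) m″
    m″<a = let _ , _ , _ , linked = M′ in
      AllPairs-++⇒All m″ (AllPairs.map⁻ (Linked.Linked⇒AllPairs Fin.<-trans linked))

    b∈L : a ≡ p → b ∈ L
    b∈L a≡p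
      -- By the partition, `b` is unscanned, an entry of `m`, or pending. The first contradicts
      -- `a < b`, the second would use `b` twice.
      with ∈-++⁻ (pairEntries m ++ L) (∈-resp-↭ (↭-sym (Partial.partition P)) (∈-allFin b))
    ... | inj₂ b∈below = ⊥-elim (ℕ.<-irrefl ≡.refl (ℕ.<-≤-trans
          (ℕ.<-≤-trans (All.lookup (below-< (suc j) j<N) b∈below)
            (ℕ.≤-reflexive (≡.cong suc (≡.sym (≡.trans (≡.cong toℕ a≡p) (Fin.toℕ-fromℕ< j<N))))))
          a<b))
      where
      a<b : a < b
      a<b = let _ , _ , inc , _ = M′ in All.head (All.++⁻ʳ m″ inc)
    ... | inj₁ b∈ with ∈-++⁻ (pairEntries m) b∈
    ...   | inj₂ b∈L = b∈L
    ...   | inj₁ b∈m = ⊥-elim (All.lookup (AllPairs.head (AllPairs.tail suffix!)) b∈m ≡.refl)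
      where
      suffix! : Unique (a ∷ b ∷ pairEntries m)
      suffix! = AllPairs-++⇒ʳ (pairEntries m″)
        (≡.subst Unique (List.concatMap-++ _ m″ _) (proj₁ M′))

    last : Dec (a ≡ p) → _ ∈ extensions (suc j) j<N L m
    last (yes ≡.refl) =
      let _ , r = ∈⇒∈-removals (b∈L ≡.refl)
      in ∈-++⁺ʳ (extensions j (ℕ.<⇒≤ j<N) (p ∷ L) m) (∈-concatMap⁺ _
           (lose r (extensions-complete j m″ (join P r) M m*≡′
             (All.map (λ q<p → ℕ.≤-trans q<p a≤j) m″<a))))
    last (no a≢p) = ∈-++⁺ˡ (extensions-complete j (m″ ∷ʳ (a , b)) (push P) M m*≡
      (All.++⁺ (All.map (λ q<a → ℕ.<-≤-trans q<a a≤j) m″<a) (a<j ∷ [])))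
      where
      a<j : toℕ a ℕ.< j
      a<j = ℕ.≤∧≢⇒< a≤j λ a≡j →
        a≢p (≡.trans (≡.sym (Fin.fromℕ<-toℕ a (Fin.toℕ<n a)))
          (Fin.fromℕ<-cong _ _ a≡j (Fin.toℕ<n a) j<N))

vectors-unique : ∀ {as : List A} k → Unique as → Unique (vectors as k)
vectors-unique zero    as! = [] ∷ []
vectors-unique (suc k) as! =
  Unique.cartesianProductWith⁺ Vec._∷_ Vec.∷-injective as! (vectors-unique k as!)

∈-vectors : ∀ {as : List A} {k} (v : Vec A k) → (∀ a → a ∈ as) → v ∈ vectors as k
∈-vectors Vec.[]      all∈ = here ≡.refl
∈-vectors (a Vec.∷ v) all∈ = ∈-cartesianProductWith⁺ Vec._∷_ (all∈ a) (∈-vectors v all∈)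

-- Two duplicate-free lists with the same members are permutations of each other, which is enough
-- for sums in a commutative ring.
perfectMatchings-↭ : ∀ n →
  map toList (perfectMatchings n) ↭ extensions (n ℕ.* 2) ℕ.≤-refl [] []
perfectMatchings-↭ n = unique∧set⇒↭
  (Unique.map⁺ (λ {v} {w} → toList-injective v w)
    (Unique.filter⁺ isPerfectMatching? (vectors-unique n
      (Unique.cartesianProduct⁺ (Unique.allFin⁺ N) (Unique.allFin⁺ N)))))
  (extensions-unique N initial)
  to from
  where
  N = n ℕ.* 2

  toList-injective : (v w : Vec (Pair N) n) → toList v ≡ toList w → v ≡ w
  toList-injective v w eq =
    ≡.trans (≡.sym (Vec.cast-is-id ≡.refl v)) (Vec.toList-injective ≡.refl v w eq)

  to : ∀ {m} → m ∈ map toList (perfectMatchings n) → m ∈ extensions N ℕ.≤-refl [] []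
  to {m} m∈ with v , v∈ , ≡.refl ← ∈-map⁻ toList m∈ =
    extensions-complete N m initial
      (proj₂ (∈-filter⁻ isPerfectMatching? {xs = vectors _ n} v∈))
      (≡.sym (List.++-identityʳ m))
      (All.tabulate (λ {q} _ → Fin.toℕ<n (proj₁ q)))

  from : ∀ {m} → m ∈ extensions N ℕ.≤-refl [] [] → m ∈ map toList (perfectMatchings n)
  -- Counting entries shows that `m` has `n` arcs; `helper` takes the length as a variable so that
  -- this equation can be matched on.
  from {m} m∈ = helper (ℕ.*-cancelʳ-≡ (length m) n 2 (complete⇒length P)) (fromList m)
    (Vec.toList∘fromList m)
    where
    P = extensions-sound N initial m∈
    helper : ∀ {k} → k ≡ n → (v : Vec (Pair N) k) → toList v ≡ m →
      m ∈ map toList (perfectMatchings n)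
    helper ≡.refl v ≡.refl = ∈-map⁺ toList (∈-filter⁺ isPerfectMatching?
      (∈-vectors v (λ (a , b) → ∈-cartesianProduct⁺ (∈-allFin a) (∈-allFin b)))
      (complete⇒IsMatching P))

-- Counting crossings and nestings during a scan

count : {P : Pred A 0ℓ} → Decidable P → List A → ℕ
count P? xs = length (filter P? xs)

count-++ : {P : Pred A 0ℓ} (P? : Decidable P) (xs ys : List A) →
  count P? (xs ++ ys) ≡ count P? xs ℕ.+ count P? ys
count-++ P? xs ys = ≡.trans (≡.cong length (List.filter-++ P? xs ys)) (List.length-++ (filter P? xs))

count-map : {P : Pred B 0ℓ} (P? : Decidable P) (f : A → B) (xs : List A) →
  count P? (map f xs) ≡ count (P? ∘ f) xs
count-map P? f []       = ≡.refl
count-map P? f (x ∷ xs) with does (P? (f x))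
... | false = count-map P? f xs
... | true  = ≡.cong suc (count-map P? f xs)

count-reject : {P : Pred A 0ℓ} (P? : Decidable P) {x : A} (xs : List A) → ¬ P x →
  count P? (x ∷ xs) ≡ count P? xs
count-reject P? xs ¬Px = ≡.cong length (List.filter-reject P? ¬Px)

count-none : {P : Pred A 0ℓ} (P? : Decidable P) {xs : List A} → All (¬_ ∘ P) xs →
  count P? xs ≡ 0
count-none P? ¬Pxs = ≡.cong length (List.filter-none P? ¬Pxs)

count-cong : {P Q : Pred A 0ℓ} (P? : Decidable P) (Q? : Decidable Q) {xs : List A} →
  All (λ x → (P x → Q x) × (Q x → P x)) xs → count P? xs ≡ count Q? xs
count-cong P? Q? []                           = ≡.refl
count-cong P? Q? {x ∷ xs} ((P⇒Q , Q⇒P) ∷ P⇔Q) with P? x | Q? x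
... | yes _ | yes _ = ≡.cong suc (count-cong P? Q? P⇔Q)
... | no _  | no _  = count-cong P? Q? P⇔Q
... | yes p | no ¬q = contradiction (P⇒Q p) ¬q
... | no ¬p | yes q = contradiction (Q⇒P q) ¬p

count-complement : {P Q : Pred A 0ℓ} (P? : Decidable P) (Q? : Decidable Q) {xs : List A} →
  All (λ x → P x ⊎ Q x) xs → All (λ x → ¬ (P x × Q x)) xs →
  count P? xs ℕ.+ count Q? xs ≡ length xs
count-complement P? Q? []            []               = ≡.refl
count-complement P? Q? {x ∷ xs} (p⊎q ∷ P⊎Q) (¬p×q ∷ ¬P×Q) with P? x | Q? x
... | yes _ | no _  = ≡.cong suc (count-complement P? Q? P⊎Q ¬P×Q)
... | no _  | yes _ = ≡.trans (ℕ.+-suc _ _) (≡.cong suc (count-complement P? Q? P⊎Q ¬P×Q))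
... | yes p | yes q = contradiction (p , q) ¬p×q
... | no ¬p | no ¬q = ⊥-elim ([ ¬p , ¬q ]′ p⊎q)

count-cartesianProduct : {P : Pred (A × B) 0ℓ} (P? : Decidable P) (xs : List A) (ys : List B) →
  count P? (cartesianProduct xs ys) ≡ sum (map (λ x → count (λ y → P? (x , y)) ys) xs)
count-cartesianProduct P? []       ys = ≡.refl
count-cartesianProduct P? (x ∷ xs) ys = ≡.trans
  (count-++ P? (map (x ,_) ys) (cartesianProduct xs ys))
  (≡.cong₂ ℕ._+_ (count-map P? (x ,_) ys) (count-cartesianProduct P? xs ys))

-- Crossing (a , b) q and Nesting (a , b) q both have the form a < proj₁ q × S b q,
-- where S does not involve a.  So an arc whose closer b is known can be counted
-- against the arcs to the right of its opener before that opener is known.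
module Counting {N : ℕ} {S : Fin N → Pair N → Set} (S? : ∀ b q → Dec (S b q)) where

  open Algebra.Properties.CommutativeSemigroup ℕ.+-commutativeSemigroup using (x∙yz≈y∙xz)

  T? : (qr : Pair N × Pair N) →
    Dec (proj₁ (proj₁ qr) < proj₁ (proj₂ qr) × S (proj₂ (proj₁ qr)) (proj₂ qr))
  T? ((a , b) , r) = a Fin.<? proj₁ r ×-dec S? b r

  total : List (Pair N) → ℕ
  total m = count T? (cartesianProduct m m)

  pending : List (Fin N) → List (Pair N) → ℕ
  pending L m = sum (map (λ b → count (S? b) m) L)

  -- The new arc opens leftmost, so it can only be the first member of a counted pair, and the
  -- condition on openers then holds automatically.
  total-∷ : ∀ {p b m} → All (λ q → p < proj₁ q) m →
    total ((p , b) ∷ m) ≡ count (S? b) m ℕ.+ total m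
  total-∷ {p} {b} {m} p<m = ≡.trans
    (count-cartesianProduct T? ((p , b) ∷ m) ((p , b) ∷ m))
    (≡.cong₂ ℕ._+_
      (≡.trans (count-reject (λ r → T? ((p , b) , r)) m (λ (p<p , _) → Fin.<-irrefl ≡.refl p<p))
        (count-cong (λ r → T? ((p , b) , r)) (S? b) (All.map (λ p<r → proj₂ , (p<r ,_)) p<m)))
      (≡.trans (tails p<m) (≡.sym (count-cartesianProduct T? m m))))
    where
    tails : ∀ {m′} → All (λ q → p < proj₁ q) m′ →
      sum (map (λ q → count (λ r → T? (q , r)) ((p , b) ∷ m)) m′) ≡
      sum (map (λ q → count (λ r → T? (q , r)) m) m′)
    tails []                   = ≡.refl
    tails {q ∷ _} (p<q ∷ p<m′) = ≡.cong₂ ℕ._+_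
      (count-reject (λ r → T? (q , r)) m (λ (q<p , _) → Fin.<-asym q<p p<q)) (tails p<m′)

  pending-∷ : ∀ L q m → pending L (q ∷ m) ≡ count (λ b → S? b q) L ℕ.+ pending L m
  pending-∷ []      q m = ≡.refl
  pending-∷ (b ∷ L) q m
    with does (S? b q)
       | ≡.trans (≡.cong (count (S? b) m ℕ.+_) (pending-∷ L q m))
           (x∙yz≈y∙xz (count (S? b) m) (count (λ c → S? c q) L) (pending L m))
  ... | false | eq = eq
  ... | true  | eq = ≡.cong suc eq

  pending-push : ∀ {b L m} → All (λ q → ¬ S b q) m → pending (b ∷ L) m ≡ pending L m
  pending-push {b} ¬S = ≡.cong (ℕ._+ _) (count-none (S? b) ¬S)

  -- Joining `p` to `b` moves the count for `b` against `m` from `pending` to `total`. What is new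
  -- comes from the closers still waiting, counted against the arc `(p , b)`.
  pending-total-∷ : ∀ {p b L L′ m} → L ↭ b ∷ L′ → All (λ q → p < proj₁ q) m →
    pending L′ ((p , b) ∷ m) ℕ.+ total ((p , b) ∷ m) ≡
    count (λ c → S? c (p , b)) L′ ℕ.+ (pending L m ℕ.+ total m)
  pending-total-∷ {p} {b} {L} {L′} {m} L↭ p<m = begin
    pending L′ ((p , b) ∷ m) ℕ.+ total ((p , b) ∷ m)
      ≡⟨ ≡.cong₂ ℕ._+_ (pending-∷ L′ (p , b) m) (total-∷ p<m) ⟩
    k ℕ.+ pending L′ m ℕ.+ (count (S? b) m ℕ.+ total m)
      ≡⟨ solve 4 (λ k s t u → (k :+ s) :+ (t :+ u) := k :+ ((t :+ s) :+ u)) ≡.refl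
           k (pending L′ m) (count (S? b) m) (total m) ⟩
    k ℕ.+ (pending (b ∷ L′) m ℕ.+ total m)
      ≡⟨ ≡.cong (λ s → k ℕ.+ (s ℕ.+ total m)) (sum-↭ (map⁺ (λ b → count (S? b) m) L↭)) ⟨
    k ℕ.+ (pending L m ℕ.+ total m) ∎
    where
    open ≡.≡-Reasoning
    open +-*-Solver
    k = count (λ c → S? c (p , b)) L′

module _ {N : ℕ} where

  -- The conjuncts are arranged so that `T?` agrees definitionally with `crossing?` and, below, with
  -- `nesting?`.
  module Crossings = Counting {N} (λ b (c , d) → c Fin.<? b ×-dec b Fin.<? d)
  module Nestings  = Counting {N} (λ b (c , d) → c Fin.<? d ×-dec d Fin.<? b)

  -- Besides the pairs inside `m`, these include the pairs that arcs closing in `L` are already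
  -- bound to form with arcs of `m`.
  crossings nestings : List (Fin N) → List (Pair N) → ℕ
  crossings L m = Crossings.pending L m ℕ.+ Crossings.total m
  nestings  L m = Nestings.pending L m ℕ.+ Nestings.total m

  smaller larger : Fin N → List (Fin N) → ℕ
  smaller b = count (Fin._<? b)
  larger  b = count (b Fin.<?_)

  smaller+larger : ∀ b {L} → All (b ≢_) L → smaller b L ℕ.+ larger b L ≡ length L
  smaller+larger b b≢L = count-complement (Fin._<? b) (b Fin.<?_) (All.map either b≢L)
    (All.tabulate (λ _ (c<b , b<c) → Fin.<-asym c<b b<c))
    where
    either : ∀ {c} → b ≢ c → c < b ⊎ b < c
    either {c} b≢c with Fin.<-cmp c b
    ... | tri< c<b _ _ = inj₁ c<b
    ... | tri≈ _ c≡b _ = contradiction (≡.sym c≡b) b≢c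
    ... | tri> _ _ b<c = inj₂ b<c

  module _ {j : ℕ} .{j<N : suc j ℕ.≤ N} {L : List (Fin N)} {m : List (Pair N)}
           (P : Partial (suc j) j<N L m) where

    private p = fromℕ< j<N

    -- An arc that closes at `p` ends before any arc of `m` opens, so it neither crosses nor
    -- encloses one.
    crossings-push : crossings (p ∷ L) m ≡ crossings L m
    crossings-push = ≡.cong (ℕ._+ _) (Crossings.pending-push {L = L} {m}
      (All.map (λ p<c (c<p , _) → Fin.<-asym p<c c<p) (p<starts P)))

    nestings-push : nestings (p ∷ L) m ≡ nestings L m
    nestings-push = ≡.cong (ℕ._+ _) (Nestings.pending-push {L = L} {m}
      (All.map (λ p<c (c<d , d<p) → Fin.<-asym p<c (Fin.<-trans c<d d<p)) (p<starts P)))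

    module _ {b : Fin N} {L′ : List (Fin N)} (r : (b , L′) ∈ removals L) where

      private
        L↭ = removals-↭ L r
        p<b∷L′ = All-resp-↭ L↭ (p<pending P)

      -- An arc that opens left of `p` and closes at a waiting `c > p` crosses `(p , b)` if `c < b`
      -- and encloses it if `b < c`.
      crossings-join : crossings L′ ((p , b) ∷ m) ≡ smaller b L′ ℕ.+ crossings L m
      crossings-join = ≡.trans (Crossings.pending-total-∷ L↭ (p<starts P))
        (≡.cong (ℕ._+ _) (count-cong _ (Fin._<? b)
          (All.map (λ p<c → proj₂ , (p<c ,_)) (All.tail p<b∷L′))))

      nestings-join : nestings L′ ((p , b) ∷ m) ≡ larger b L′ ℕ.+ nestings L m
      nestings-join = ≡.trans (Nestings.pending-total-∷ L↭ (p<starts P))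
        (≡.cong (ℕ._+ nestings L m) (count-cong _ (b Fin.<?_) {L′}
          (All.tabulate (λ _ → proj₂ , (All.head p<b∷L′ ,_)))))

      smaller+larger-removal : smaller b L′ ℕ.+ larger b L′ ≡ length L′
      smaller+larger-removal = smaller+larger b (AllPairs.head
        (Unique-resp-↭ L↭ (AllPairs.map Fin.<⇒≢ (Partial.ascending P))))

-- The λ-Pfaffian as a signed sum over scans

module Scans (R : CommutativeRing a ℓ) (l : CommutativeRing.Carrier R) where

  open CommutativeRing R hiding (zero)
  open import Algebra.Properties.Ring ring using (-0#≈0#; -1*x≈-x)
  open import Algebra.Properties.Semiring.Exp semiring using (_^_; ^-homo-*)
  open Algebra.Properties.CommutativeSemigroup *-commutativeSemigroup using (interchange)
  open Algebra.Properties.CommutativeSemigroup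
    (CommutativeMonoid.commutativeSemigroup +-commutativeMonoid)
    using () renaming (x∙yz≈y∙xz to x+yz≈y+xz)
  open import Relation.Binary.Reasoning.Setoid setoid

  -- A Laplace-type expansion: the sign is the parity of the position of the removed element, kept
  -- as nested subtraction.
  alternatingSum : (A → List A → Carrier) → List A → Carrier
  alternatingSum f []      = 0#
  alternatingSum f (b ∷ L) = f b L - alternatingSum (λ c L′ → f c (b ∷ L′)) L

  x-0≈x : ∀ x → x - 0# ≈ x
  x-0≈x x = trans (+-congˡ -0#≈0#) (+-identityʳ x)

  -‿cong₂ : ∀ {w x y z} → w ≈ x → y ≈ z → w - y ≈ x - z
  -‿cong₂ w≈x y≈z = +-cong w≈x (-‿cong y≈z)

  -- The length equation allows an `f` that is known to vanish only when enough elements remain.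
  alternatingSum-zero : ∀ (f : A → List A → Carrier) L →
    (∀ b L′ → length L ≡ suc (length L′) → f b L′ ≈ 0#) →
    alternatingSum f L ≈ 0#
  alternatingSum-zero f []      f≈0 = refl
  alternatingSum-zero f (b ∷ L) f≈0 = trans
    (-‿cong₂ (f≈0 b L ≡.refl)
      (alternatingSum-zero _ L (λ c L′ eq → f≈0 c (b ∷ L′) (≡.cong suc eq))))
    (x-0≈x 0#)

  module _ {N : ℕ} (w : Fin N → Fin N → Carrier) where

    -- Mirrors the recursion of `extensions` but forgets `m`: the cost of a join depends only on the
    -- waiting closers.
    completions : ∀ j → .(j ℕ.≤ N) → List (Fin N) → Carrier
    completions zero    _   []      = 1#
    completions zero    _   (_ ∷ _) = 0#
    completions (suc j) j<N L       =
      completions j (ℕ.<⇒≤ j<N) (p ∷ L) +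
      alternatingSum
        (λ b L′ → l ^ length L′ * (w p b * completions j (ℕ.<⇒≤ j<N) L′)) L
      where p = fromℕ< j<N

  sumOver : (A → Carrier) → List A → Carrier
  sumOver f xs = foldr _+_ 0# (map f xs)

  sumOver-cong : ∀ {f g : A → Carrier} xs → (∀ {x} → x ∈ xs → f x ≈ g x) →
    sumOver f xs ≈ sumOver g xs
  sumOver-cong []       f≈g = refl
  sumOver-cong (x ∷ xs) f≈g = +-cong (f≈g (here ≡.refl)) (sumOver-cong xs (f≈g ∘ there))

  sumOver-++ : ∀ (f : A → Carrier) xs ys → sumOver f (xs ++ ys) ≈ sumOver f xs + sumOver f ys
  sumOver-++ f []       ys = sym (+-identityˡ _)
  sumOver-++ f (x ∷ xs) ys = trans (+-congˡ (sumOver-++ f xs ys)) (sym (+-assoc _ _ _))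

  sumOver-concatMap : ∀ (f : B → Carrier) (g : A → List B) xs →
    sumOver f (concatMap g xs) ≈ sumOver (λ x → sumOver f (g x)) xs
  sumOver-concatMap f g []       = refl
  sumOver-concatMap f g (x ∷ xs) =
    trans (sumOver-++ f (g x) _) (+-congˡ (sumOver-concatMap f g xs))

  sumOver-*ˡ : ∀ c (f : A → Carrier) xs → sumOver (λ x → c * f x) xs ≈ c * sumOver f xs
  sumOver-*ˡ c f []       = sym (zeroʳ c)
  sumOver-*ˡ c f (x ∷ xs) = trans (+-congˡ (sumOver-*ˡ c f xs)) (sym (distribˡ _ _ _))

  sumOver-map : ∀ (f : B → Carrier) (g : A → B) xs → sumOver f (map g xs) ≡ sumOver (f ∘ g) xs
  sumOver-map f g xs = ≡.cong (foldr _+_ 0#) (≡.sym (List.map-∘ xs))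

  sumOver-↭ : ∀ (f : A → Carrier) {xs ys} → xs ↭ ys → sumOver f xs ≈ sumOver f ys
  sumOver-↭ f Perm.refl         = refl
  sumOver-↭ f (Perm.prep x p)   = +-congˡ (sumOver-↭ f p)
  sumOver-↭ f (Perm.swap x y p) =
    trans (x+yz≈y+xz (f x) (f y) _) (+-congˡ (+-congˡ (sumOver-↭ f p)))
  sumOver-↭ f (Perm.trans p q)  = trans (sumOver-↭ f p) (sumOver-↭ f q)

  -- In an ascending list the number of smaller elements is the position, so the crossing sign is
  -- the alternating one.
  sumOver-removals : ∀ {N} (f : Fin N → List (Fin N) → Carrier) L → AllPairs _<_ L →
    sumOver (λ (b , L′) → (- 1#) ^ smaller b L′ * f b L′) (removals L) ≈ alternatingSum f L
  sumOver-removals f []      _          = refl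
  sumOver-removals f (b ∷ L) (b<L ∷ L<) = +-cong
    (begin
      (- 1#) ^ smaller b L * f b L
        ≡⟨ ≡.cong (λ k → (- 1#) ^ k * f b L)
             (count-none (Fin._<? b) (All.map (λ b<c c<b → Fin.<-asym b<c c<b) b<L)) ⟩
      1# * f b L
        ≈⟨ *-identityˡ _ ⟩
      f b L ∎)
    (begin
      sumOver (λ (c , L′) → (- 1#) ^ smaller c L′ * f c L′) (map (map₂ (b ∷_)) (removals L))
        ≡⟨ sumOver-map _ (map₂ (b ∷_)) (removals L) ⟩
      sumOver (λ (c , L′) → (- 1#) ^ smaller c (b ∷ L′) * f c (b ∷ L′)) (removals L)
        ≈⟨ sumOver-cong (removals L) (λ {(c , L′)} r → begin
             (- 1#) ^ smaller c (b ∷ L′) * f c (b ∷ L′)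
               ≡⟨ ≡.cong (λ k → (- 1#) ^ k * f c (b ∷ L′)) (≡.cong length
                    (List.filter-accept (Fin._<? c) (All.head (All-resp-↭ (removals-↭ L r) b<L)))) ⟩
             (- 1#) * (- 1#) ^ smaller c L′ * f c (b ∷ L′)
               ≈⟨ *-assoc _ _ _ ⟩
             (- 1#) * ((- 1#) ^ smaller c L′ * f c (b ∷ L′)) ∎) ⟩
      sumOver (λ (c , L′) → (- 1#) * ((- 1#) ^ smaller c L′ * f c (b ∷ L′))) (removals L)
        ≈⟨ sumOver-*ˡ (- 1#) _ (removals L) ⟩
      (- 1#) * sumOver (λ (c , L′) → (- 1#) ^ smaller c L′ * f c (b ∷ L′)) (removals L)
        ≈⟨ trans (*-congˡ (sumOver-removals (λ c L′ → f c (b ∷ L′)) L L<)) (-1*x≈-x _) ⟩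
      - alternatingSum (λ c L′ → f c (b ∷ L′)) L ∎)

  module _ {N : ℕ} (w : Fin N → Fin N → Carrier) where

    product : List (Pair N) → Carrier
    product = foldr (λ (i , j) → w i j *_) 1#

    weight : List (Fin N) → List (Pair N) → Carrier
    weight L m = (- 1#) ^ crossings L m * l ^ (crossings L m ℕ.+ nestings L m) * product m

    weight-push : ∀ {j} .{j<N : suc j ℕ.≤ N} {L m} → Partial (suc j) j<N L m →
      weight (fromℕ< j<N ∷ L) m ≡ weight L m
    weight-push {m = m} P = ≡.cong₂
      (λ s t → (- 1#) ^ s * l ^ (s ℕ.+ t) * product m) (crossings-push P) (nestings-push P)

    -- Each remaining closer adds exactly one crossing or nesting, whence the power `length L′` of
    -- `l`; only the crossings contribute signs.
    weight-join : ∀ {j} .{j<N : suc j ℕ.≤ N} {L m b L′} → Partial (suc j) j<N L m →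
      (b , L′) ∈ removals L → let p = fromℕ< j<N in
      weight L′ ((p , b) ∷ m) ≈
      weight L m * ((- 1#) ^ smaller b L′ * (l ^ length L′ * w p b))
    weight-join {j<N = j<N} {L} {m} {b} {L′} P r = begin
      (- 1#) ^ crossings L′ ((p , b) ∷ m) *
        l ^ (crossings L′ ((p , b) ∷ m) ℕ.+ nestings L′ ((p , b) ∷ m)) * (w p b * product m)
        ≡⟨ ≡.cong₂ (λ s t → (- 1#) ^ s * l ^ t * (w p b * product m)) (crossings-join P r)
             (≡.trans (≡.cong₂ ℕ._+_ (crossings-join P r) (nestings-join P r)) exponents) ⟩
      (- 1#) ^ (smaller b L′ ℕ.+ crossings L m) *
        l ^ (length L′ ℕ.+ (crossings L m ℕ.+ nestings L m)) * (w p b * product m)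
        ≈⟨ *-congʳ (*-cong (^-homo-* (- 1#) (smaller b L′) _) (^-homo-* l (length L′) _)) ⟩
      (- 1#) ^ smaller b L′ * (- 1#) ^ crossings L m *
        (l ^ length L′ * l ^ (crossings L m ℕ.+ nestings L m)) * (w p b * product m)
        ≈⟨ *-congʳ (interchange _ _ _ _) ⟩
      (- 1#) ^ smaller b L′ * l ^ length L′ *
        ((- 1#) ^ crossings L m * l ^ (crossings L m ℕ.+ nestings L m)) * (w p b * product m)
        ≈⟨ interchange _ _ _ _ ⟩
      (- 1#) ^ smaller b L′ * l ^ length L′ * w p b * weight L m
        ≈⟨ trans (*-comm _ _) (*-congˡ (*-assoc _ _ _)) ⟩
      weight L m * ((- 1#) ^ smaller b L′ * (l ^ length L′ * w p b)) ∎
      where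
      p = fromℕ< j<N
      exponents : smaller b L′ ℕ.+ crossings L m ℕ.+ (larger b L′ ℕ.+ nestings L m) ≡
                  length L′ ℕ.+ (crossings L m ℕ.+ nestings L m)
      exponents = ≡.trans
        (solve 4 (λ s c t n → (s :+ c) :+ (t :+ n) := (s :+ t) :+ (c :+ n)) ≡.refl
          (smaller b L′) (crossings L m) (larger b L′) (nestings L m))
        (≡.cong (ℕ._+ _) (smaller+larger-removal P r))
        where open +-*-Solver

    -- Costs multiply along a scan, so the part already incurred factors out of the sum over all
    -- continuations.
    sumOver-extensions : ∀ j .{j≤N : j ℕ.≤ N} L {m} → Partial j j≤N L m →
      sumOver (weight []) (extensions j j≤N L m) ≈ weight L m * completions w j j≤N L
    sumOver-extensions zero    []      P = trans (+-identityʳ _) (sym (*-identityʳ _))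
    sumOver-extensions zero    (b ∷ L) P = sym (zeroʳ _)
    sumOver-extensions (suc j) {j<N} L {m} P = begin
      sumOver (weight []) (extensions j (ℕ.<⇒≤ j<N) (p ∷ L) m ++ concatMap joined (removals L))
        ≈⟨ sumOver-++ (weight []) (extensions j (ℕ.<⇒≤ j<N) (p ∷ L) m) _ ⟩
      sumOver (weight []) (extensions j (ℕ.<⇒≤ j<N) (p ∷ L) m) +
      sumOver (weight []) (concatMap joined (removals L))
        ≈⟨ +-cong
             (trans (sumOver-extensions j (p ∷ L) (push P))
               (*-congʳ (reflexive (weight-push P))))
             (trans (sumOver-concatMap (weight []) joined (removals L))
               (sumOver-cong (removals L) join-weight)) ⟩
      weight L m * G (p ∷ L) +
      sumOver (λ (b , L′) → weight L m * ((- 1#) ^ smaller b L′ * f b L′)) (removals L)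
        ≈⟨ +-congˡ (trans (sumOver-*ˡ (weight L m) _ (removals L))
             (*-congˡ (sumOver-removals f L (Partial.ascending P)))) ⟩
      weight L m * G (p ∷ L) + weight L m * alternatingSum f L
        ≈⟨ distribˡ _ _ _ ⟨
      weight L m * (G (p ∷ L) + alternatingSum f L) ∎
      where
      p = fromℕ< j<N
      G = completions w j (ℕ.<⇒≤ j<N)
      f : Fin N → List (Fin N) → Carrier
      f b L′ = l ^ length L′ * (w p b * G L′)
      joined : Fin N × List (Fin N) → List (List (Pair N))
      joined (b , L′) = extensions j (ℕ.<⇒≤ j<N) L′ ((p , b) ∷ m)

      join-weight : ∀ {r} → r ∈ removals L →
        sumOver (weight []) (joined r) ≈
        weight L m * ((- 1#) ^ smaller (proj₁ r) (proj₂ r) * f (proj₁ r) (proj₂ r))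
      join-weight {b , L′} r = begin
        sumOver (weight []) (joined (b , L′))
          ≈⟨ sumOver-extensions j L′ (join P r) ⟩
        weight L′ ((p , b) ∷ m) * G L′
          ≈⟨ *-congʳ (weight-join P r) ⟩
        weight L m * ((- 1#) ^ smaller b L′ * (l ^ length L′ * w p b)) * G L′
          ≈⟨ trans (*-assoc _ _ _) (*-congˡ (trans (*-assoc _ _ _) (*-congˡ (*-assoc _ _ _)))) ⟩
        weight L m * ((- 1#) ^ smaller b L′ * f b L′) ∎

    ∏-lookup : ∀ {k} (v : Vec (Pair N) k) →
      ∏ R (λ i → uncurry w (lookup v i)) ≈ product (toList v)
    ∏-lookup Vec.[]      = refl
    ∏-lookup (q Vec.∷ v) = *-congˡ (∏-lookup v)

  Pf-completions : ∀ n (w : Fin (n ℕ.* 2) → Fin (n ℕ.* 2) → Carrier) →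
    Pf R l n w ≈ completions w (n ℕ.* 2) ℕ.≤-refl []
  Pf-completions n w = begin
    sumOver (summand R l w) (perfectMatchings n)
      -- With nothing pending, `crossings` and `nestings` reduce to `cross` and `nest`; only the
      -- product over arcs has to be rewritten.
      ≈⟨ sumOver-cong (perfectMatchings n) (λ {v} _ → *-congˡ (∏-lookup w v)) ⟩
    sumOver (weight w [] ∘ toList) (perfectMatchings n)
      ≡⟨ sumOver-map (weight w []) toList (perfectMatchings n) ⟨
    sumOver (weight w []) (map toList (perfectMatchings n))
      ≈⟨ sumOver-↭ (weight w []) (perfectMatchings-↭ n) ⟩
    sumOver (weight w []) (extensions (n ℕ.* 2) ℕ.≤-refl [] [])
      ≈⟨ sumOver-extensions w (n ℕ.* 2) [] initial ⟩
    -- The leading factor is `weight w [] []`, the cost of the empty scan.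
    1# * 1# * 1# * completions w (n ℕ.* 2) ℕ.≤-refl []
      ≈⟨ trans (*-congʳ (trans (*-identityʳ _) (*-identityʳ _))) (*-identityˡ _) ⟩
    completions w (n ℕ.* 2) ℕ.≤-refl [] ∎

  -- u is the x or the y of the first position of a block: the two rows of the
  -- block's matrix are the images of each other under the preceding σ.
  row : (u x₂ y₂ b b′ : Carrier) → Carrier
  row u x₂ y₂ b b′ = (u - y₂) * b - l * ((u - x₂) * b′)

  -- First column of the product of the block matrices with rows `(x₁ - y₂ , - l (x₁ - x₂))` and
  -- `(y₁ - y₂ , - l (y₁ - x₂))`.
  transfer : ∀ r → (X Y : Fin (r ℕ.* 2) → Carrier) → Carrier × Carrier
  transfer zero    X Y = 1# , 0#
  transfer (suc r) X Y =
    let b , b′ = transfer r (λ i → X (suc (suc i))) (λ i → Y (suc (suc i)))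
    in row (X zero) (X (suc zero)) (Y (suc zero)) b b′ ,
       row (Y zero) (X (suc zero)) (Y (suc zero)) b b′

  row-cong : ∀ {u u′ v v′ w w′ b b″ c c″} →
    u ≈ u′ → v ≈ v′ → w ≈ w′ → b ≈ b″ → c ≈ c″ → row u v w b c ≈ row u′ v′ w′ b″ c″
  row-cong u≈ v≈ w≈ b≈ c≈ = +-cong
    (*-cong (+-cong u≈ (-‿cong w≈)) b≈)
    (-‿cong (*-congˡ (*-cong (+-cong u≈ (-‿cong v≈)) c≈)))

-- Scans for `X a - Y b` evaluated by 2 × 2 matrices

module TransferMatrices
  (R : CommutativeRing a ℓ)
  (ι : CommutativeRing.Carrier ℤ.+-*-commutativeRing → CommutativeRing.Carrier R)
  (ι-hom : IsRingHomomorphism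
    (CommutativeRing.rawRing ℤ.+-*-commutativeRing) (CommutativeRing.rawRing R) ι)
  (l : CommutativeRing.Carrier R)
  where

  open CommutativeRing R hiding (zero)
  open Scans R l
  open import Algebra.Properties.Semiring.Exp semiring using (_^_)
  open import Relation.Binary.Reasoning.Setoid setoid

  private
    module ι = IsRingHomomorphism ι-hom

    ι-morphism :
      CommutativeRing.rawRing ℤ.+-*-commutativeRing -Raw-AlmostCommutative⟶ fromCommutativeRing R
    ι-morphism = record
      { ⟦_⟧    = ι
      ; +-homo = ι.+-homo
      ; *-homo = ι.*-homo
      ; -‿homo = ι.-‿homo
      ; 0-homo = ι.0#-homo
      ; 1-homo = ι.1#-homo
      }

    weaklyDecidable : ∀ i j → Maybe (ι i ≈ ι j)
    weaklyDecidable i j with i ℤ.≟ j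
    ... | yes i≡j = just (ι.⟦⟧-cong i≡j)
    ... | no _    = nothing

  -- Integer coefficients let the solver cancel terms, which it could not do
  -- with coefficients in R, whose equality need not be decidable.
  open Algebra.Solver.Ring
    (CommutativeRing.rawRing ℤ.+-*-commutativeRing)
    (fromCommutativeRing R)
    ι-morphism
    weaklyDecidable
    using (solve; _:=_; _:+_; _:*_; _:-_)

  -- Coordinates in the exterior algebra of a plane: `s` in degree 0, `α` and `β` in degree 1, `γ`
  -- in degree 2.
  record State : Set a where
    constructor state
    field
      s α β γ : Carrier

  -- The new coordinates are read off from the recursion of `completions` at lists of length 0, 1
  -- and 2.
  step : Carrier → Carrier → State → State
  step x y (state s α β γ) =
    state (α - β * y) (γ * y + s * x) (γ + s) (l * (x * β - α))

  module _ {N : ℕ} (X Y : Fin N → Carrier) where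

    -- `completions` at `j` concerns the positions below `j`, so the states are built from left to
    -- right although scans run the other way.
    states : ∀ j → .(j ℕ.≤ N) → State
    states zero    _   = state 1# 0# 0# 0#
    states (suc j) j<N =
      step (X (fromℕ< j<N)) (Y (fromℕ< j<N)) (states j (ℕ.<⇒≤ j<N))

    record _Represents_ (st : State) (G : List (Fin N) → Carrier) : Set ℓ where
      open State st
      field
        none : G [] ≈ s
        one  : ∀ b → G (b ∷ []) ≈ α - β * Y b
        two  : ∀ b c → G (b ∷ c ∷ []) ≈ γ * (Y b - Y c)
        many : ∀ b c d L → G (b ∷ c ∷ d ∷ L) ≈ 0#

    represents : ∀ j .(j≤N : j ℕ.≤ N) →
      states j j≤N Represents completions (λ a b → X a - Y b) j j≤N
    represents zero j≤N = record
      { none = refl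
      ; one  = λ b → sym (trans (-‿cong₂ refl (zeroˡ _)) (x-0≈x 0#))
      ; two  = λ _ _ → sym (zeroˡ _)
      ; many = λ _ _ _ _ → refl
      }
    represents (suc j) j<N = record
      { none = trans (+-identityʳ _) (one p)
      ; one  = λ b → begin
          G (p ∷ b ∷ []) + (1# * ((X p - Y b) * G []) - 0#)
            ≈⟨ +-cong (two p b)
                 (trans (x-0≈x _) (trans (*-identityˡ _) (*-congˡ none))) ⟩
          γ * (Y p - Y b) + (X p - Y b) * s
            ≈⟨ solve 5 (λ γ s x y b →
                 γ :* (y :- b) :+ (x :- b) :* s :=
                 (γ :* y :+ s :* x) :- (γ :+ s) :* b)
                 refl γ s (X p) (Y p) (Y b) ⟩
          (γ * Y p + s * X p) - (γ + s) * Y b ∎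
      ; two  = λ b c → begin
          G (p ∷ b ∷ c ∷ []) +
          (l * 1# * ((X p - Y b) * G (c ∷ [])) -
          (l * 1# * ((X p - Y c) * G (b ∷ [])) - 0#))
            ≈⟨ trans (+-cong (many p b c [])
                 (-‿cong₂ (*-cong (*-identityʳ l) (*-congˡ (one c)))
                   (trans (x-0≈x _) (*-cong (*-identityʳ l) (*-congˡ (one b))))))
                 (+-identityˡ _) ⟩
          l * ((X p - Y b) * (α - β * Y c)) - l * ((X p - Y c) * (α - β * Y b))
            ≈⟨ solve 6 (λ l α β x b c →
                 l :* ((x :- b) :* (α :- β :* c)) :- l :* ((x :- c) :* (α :- β :* b)) :=
                 l :* (x :* β :- α) :* (b :- c))
                 refl l α β (X p) (Y b) (Y c) ⟩
          l * (X p * β - α) * (Y b - Y c) ∎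
      ; many = λ where
          b c d []      → begin
            G (p ∷ b ∷ c ∷ d ∷ []) +
            (l * (l * 1#) * ((X p - Y b) * G (c ∷ d ∷ [])) -
            (l * (l * 1#) * ((X p - Y c) * G (b ∷ d ∷ [])) -
            (l * (l * 1#) * ((X p - Y d) * G (b ∷ c ∷ [])) - 0#)))
              ≈⟨ trans (+-cong (many p b c (d ∷ []))
                   (-‿cong₂ (*-congˡ (*-congˡ (two c d)))
                     (-‿cong₂ (*-congˡ (*-congˡ (two b d)))
                       (trans (x-0≈x _) (*-congˡ (*-congˡ (two b c)))))))
                   (+-identityˡ _) ⟩
            l * (l * 1#) * ((X p - Y b) * (γ * (Y c - Y d))) -
            (l * (l * 1#) * ((X p - Y c) * (γ * (Y b - Y d))) -
            l * (l * 1#) * ((X p - Y d) * (γ * (Y b - Y c))))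
              -- The three-term Plücker relation `(x - b)(c - d) - (x - c)(b - d) + (x - d)(b - c) =
              -- 0`. The right side is `m :- m` because a solver constant would denote its image
              -- under `ι`.
              ≈⟨ solve 6 (λ m γ x b c d →
                   m :* ((x :- b) :* (γ :* (c :- d))) :-
                   (m :* ((x :- c) :* (γ :* (b :- d))) :-
                   m :* ((x :- d) :* (γ :* (b :- c)))) :=
                   m :- m)
                   refl (l * (l * 1#)) γ (X p) (Y b) (Y c) (Y d) ⟩
            l * (l * 1#) - l * (l * 1#)
              ≈⟨ -‿inverseʳ _ ⟩
            0# ∎
          -- From length four on, every removal leaves at least three closers, so each term vanishes
          -- separately.
          b c d (e ∷ L) → trans
            (+-cong (many p b c (d ∷ e ∷ L))
              (alternatingSum-zero f (b ∷ c ∷ d ∷ e ∷ L) (λ where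
                u (b ∷ c ∷ d ∷ L′) _ →
                  trans (*-congˡ (trans (*-congˡ (many b c d L′)) (zeroʳ _))) (zeroʳ _))))
            (+-identityʳ _)
      }
      where
      p = fromℕ< j<N
      G = completions (λ a b → X a - Y b) j (ℕ.<⇒≤ j<N)
      f : Fin N → List (Fin N) → Carrier
      f b L′ = l ^ length L′ * ((X p - Y b) * G L′)
      open State (states j (ℕ.<⇒≤ j<N))
      open _Represents_ (represents j (ℕ.<⇒≤ j<N))

  module _ {N : ℕ} (X Y : Fin N → Carrier) where

    -- (s , γ) times the remaining matrices, read off in the first column, does
    -- not depend on the position at which the product is split.
    states-transfer : ∀ r j .(j≤N : j ℕ.≤ N) → j ℕ.+ r ℕ.* 2 ≡ N →
      (e : Fin (r ℕ.* 2) → Fin N) → (∀ t → toℕ (e t) ≡ j ℕ.+ toℕ t) →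
      let open State (states X Y j j≤N)
          b , b′ = transfer r (X ∘ e) (Y ∘ e)
      in s * b + γ * b′ ≈ State.s (states X Y N ℕ.≤-refl)
    states-transfer zero j j≤N eq e e≡ with ≡.trans (≡.sym (ℕ.+-identityʳ j)) eq
    ... | ≡.refl = trans (+-cong (*-identityʳ _) (zeroʳ _)) (+-identityʳ _)
    states-transfer (suc r) j j≤N eq e e≡ = begin
      s * row x₁ x₂ y₂ b b′ + γ * row y₁ x₂ y₂ b b′
        ≈⟨ solve 9 (λ l s γ x₁ y₁ x₂ y₂ b b′ →
             s :* ((x₁ :- y₂) :* b :- l :* ((x₁ :- x₂) :* b′)) :+
             γ :* ((y₁ :- y₂) :* b :- l :* ((y₁ :- x₂) :* b′)) :=
             ((γ :* y₁ :+ s :* x₁) :- (γ :+ s) :* y₂) :* b :+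
             l :* (x₂ :* (γ :+ s) :- (γ :* y₁ :+ s :* x₁)) :* b′)
             refl l s γ x₁ y₁ x₂ y₂ b b′ ⟩
      ((γ * y₁ + s * x₁) - (γ + s) * y₂) * b +
      l * (x₂ * (γ + s) - (γ * y₁ + s * x₁)) * b′
        -- These are `s` and `γ` after two steps: one step makes the new `α` and `β` out of `s` and
        -- `γ`, so the old `α` and `β` drop out. It remains to match `e` with the positions used by
        -- `states`.
        ≡⟨ ≡.cong₂ (λ p q →
             ((γ * Y p + s * X p) - (γ + s) * Y q) * b +
             l * (X q * (γ + s) - (γ * Y p + s * X p)) * b′) p≡ q≡ ⟩
      State.s (states X Y (suc (suc j)) 2+j≤N) * b + State.γ (states X Y (suc (suc j)) 2+j≤N) * b′
        ≈⟨ states-transfer r (suc (suc j)) 2+j≤N eq′ (λ t → e (suc (suc t)))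
             (λ t → ≡.trans (e≡ (suc (suc t))) (+-2+ (toℕ t))) ⟩
      State.s (states X Y N ℕ.≤-refl) ∎
      where
      open State (states X Y j j≤N)
      x₁ = X (e zero); x₂ = X (e (suc zero)); y₁ = Y (e zero); y₂ = Y (e (suc zero))
      b  = proj₁ (transfer r (λ i → X (e (suc (suc i)))) (λ i → Y (e (suc (suc i)))))
      b′ = proj₂ (transfer r (λ i → X (e (suc (suc i)))) (λ i → Y (e (suc (suc i)))))
      +-2+ : ∀ t → j ℕ.+ suc (suc t) ≡ suc (suc j) ℕ.+ t
      +-2+ t = ≡.trans (ℕ.+-suc j (suc t)) (≡.cong suc (ℕ.+-suc j t))
      eq′ : suc (suc j) ℕ.+ r ℕ.* 2 ≡ N
      eq′ = ≡.trans (≡.sym (+-2+ (r ℕ.* 2))) eq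
      2+j≤N : suc (suc j) ℕ.≤ N
      2+j≤N = ≡.subst (suc (suc j) ℕ.≤_) eq′ (ℕ.m≤m+n (suc (suc j)) (r ℕ.* 2))
      at : ∀ t {k} .(k<N : k ℕ.< N) → toℕ (e t) ≡ k → e t ≡ fromℕ< k<N
      at t k<N ≡.refl = ≡.sym (Fin.fromℕ<-toℕ (e t) k<N)
      p≡ : e zero ≡ fromℕ< {m = j} (ℕ.<⇒≤ 2+j≤N)
      p≡ = at zero (ℕ.<⇒≤ 2+j≤N) (≡.trans (e≡ zero) (ℕ.+-identityʳ j))
      q≡ : e (suc zero) ≡ fromℕ< {m = suc j} 2+j≤N
      q≡ = at (suc zero) 2+j≤N
        (≡.trans (e≡ (suc zero)) (≡.trans (ℕ.+-suc j 0) (≡.cong suc (ℕ.+-identityʳ j))))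

  completions-transfer : ∀ n (X Y : Fin (n ℕ.* 2) → Carrier) →
    completions (λ a b → X a - Y b) (n ℕ.* 2) ℕ.≤-refl [] ≈ proj₁ (transfer n X Y)
  completions-transfer n X Y = begin
    completions (λ a b → X a - Y b) (n ℕ.* 2) ℕ.≤-refl []
      ≈⟨ _Represents_.none (represents X Y (n ℕ.* 2) ℕ.≤-refl) ⟩
    State.s (states X Y (n ℕ.* 2) ℕ.≤-refl)
      ≈⟨ states-transfer X Y n 0 ℕ.z≤n ≡.refl id (λ _ → ≡.refl) ⟨
    1# * b + 0# * b′
      ≈⟨ trans (+-cong (*-identityˡ b) (zeroˡ b′)) (+-identityʳ b) ⟩
    b ∎
    where
    b  = proj₁ (transfer n X Y)
    b′ = proj₂ (transfer n X Y)

-- Expansion of the operators 1 - λσ₂ₖ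

module Operators (n : ℕ) where

  open ℤ[λ][x,y] n using (Poly; C; C-isRingHomomorphism; commutativeRing; _≈_; _*_; _-_;
    ƛ; x; y; σ; σ-var; eval-cong; 1-ƛσ)
  open CommutativeRing commutativeRing
    using (setoid; refl; sym; trans; +-cong; *-cong; +-congˡ; *-congˡ; -‿cong;
           *-assoc; *-comm; +-identityʳ; zeroʳ; distribˡ; ring; _+_; -_)
  open import Algebra.Properties.Ring ring using (-0#≈0#; -‿distribʳ-*)
  open import Relation.Binary.Reasoning.Setoid setoid

  -- Provides the integer coefficients for the ring solver of `TransferMatrices`.
  ℤ-hom : IsRingHomomorphism _ (CommutativeRing.rawRing commutativeRing) (C ∘ ℤ[λ].C)
  ℤ-hom = Composition.isRingHomomorphism trans
    ℤ[λ].C-isRingHomomorphism C-isRingHomomorphism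

  open Scans commutativeRing ƛ using (row-cong; transfer)

  σ-cong : ∀ k {p q} → p ≈ q → σ k p ≈ σ k q
  σ-cong k = eval-cong commutativeRing C-isRingHomomorphism (σ-var k)

  σ-x-moved : ∀ {k} i → index i ≡ suc k → σ k (x i) ≈ y i
  σ-x-moved {k} i eq rewrite dec-true (index i ℕ.≟ suc k) eq = refl

  σ-x-fixed : ∀ {k} i → index i ≢ suc k → σ k (x i) ≈ x i
  σ-x-fixed {k} i neq rewrite dec-false (index i ℕ.≟ suc k) neq = refl

  σ-y-moved : ∀ {k} i → index i ≡ k → σ k (y i) ≈ x i
  σ-y-moved {k} i eq rewrite dec-true (index i ℕ.≟ k) eq = refl

  σ-y-fixed : ∀ {k} i → index i ≢ k → σ k (y i) ≈ y i
  σ-y-fixed {k} i neq rewrite dec-false (index i ℕ.≟ k) neq = refl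

  1-ƛσ-cong : ∀ k {p q} → p ≈ q → 1-ƛσ k p ≈ 1-ƛσ k q
  1-ƛσ-cong k p≈q = +-cong p≈q (-‿cong (*-congˡ (σ-cong k p≈q)))

  -- σ is multiplicative, so the operator is linear over the elements that σ fixes.
  1-ƛσ-* : ∀ k {f} p → σ k f ≈ f → 1-ƛσ k (f * p) ≈ f * 1-ƛσ k p
  1-ƛσ-* k {f} p σf≈f = begin
    f * p - ƛ * (σ k f * σ k p)   ≈⟨ +-congˡ (-‿cong factor-out) ⟩
    f * p - f * (ƛ * σ k p)       ≈⟨ +-congˡ (-‿distribʳ-* f _) ⟩
    f * p + f * - (ƛ * σ k p)     ≈⟨ distribˡ f p _ ⟨
    f * (p - ƛ * σ k p)           ∎
    where
    factor-out : ƛ * (σ k f * σ k p) ≈ f * (ƛ * σ k p)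
    factor-out = begin
      ƛ * (σ k f * σ k p)  ≈⟨ *-assoc ƛ _ _ ⟨
      ƛ * σ k f * σ k p    ≈⟨ *-cong (trans (*-comm ƛ _) (*-cong σf≈f refl)) refl ⟩
      f * ƛ * σ k p        ≈⟨ *-assoc f ƛ _ ⟩
      f * (ƛ * σ k p)      ∎

  -- `∏[1-ƛσ]` for an arbitrary list of indices, so that an induction can drop the first block.
  ops : List ℕ → Poly → Poly
  ops ks = foldr _∘_ id (map (λ k → 1-ƛσ (2 ℕ.* k)) ks)

  ops-* : ∀ {ks f} p → All (λ k → σ (2 ℕ.* k) f ≈ f) ks → ops ks (f * p) ≈ f * ops ks p
  ops-* p []                       = refl
  ops-* {k ∷ ks} p (fixed ∷ fixeds) = trans
    (1-ƛσ-cong (2 ℕ.* k) (ops-* p fixeds)) (1-ƛσ-* (2 ℕ.* k) (ops ks p) fixed)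

  -- σ fixes `ƛ` and, being an evaluation, commutes definitionally with the ring operations from
  -- which `row` is built.
  transfer-fixed : ∀ k r {X Y : Fin (r ℕ.* 2) → Poly} →
    (∀ i → σ k (X i) ≈ X i) → (∀ i → σ k (Y i) ≈ Y i) →
    let b , b′ = transfer r X Y in σ k b ≈ b × σ k b′ ≈ b′
  transfer-fixed k zero    σX σY = refl , refl
  transfer-fixed k (suc r) σX σY =
    let σb , σb′ = transfer-fixed k r (λ i → σX (suc (suc i))) (λ i → σY (suc (suc i)))
    in row-cong (σX zero) (σX (suc zero)) (σY (suc zero)) σb σb′ ,
       row-cong (σY zero) (σX (suc zero)) (σY (suc zero)) σb σb′

  factors : ∀ r → (Fin (r ℕ.* 2) → Fin (n ℕ.* 2)) → Poly
  factors r e = ∏ commutativeRing (λ (i : Fin r) → x (e (odd i)) - y (e (even i)))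

  -- The later operators fix the first factor, so by induction they turn the other factors into `b`.
  -- The first operator then exchanges `y` for `x` at the end of its block and `x` for `y` at the
  -- start of the next, sending `b` to `b′`: exactly the first row. `k` counts the blocks already
  -- dropped.
  ops-factors : ∀ r k {f} → (∀ i → f i ≡ suc k ℕ.+ i) →
    (e : Fin (suc r ℕ.* 2) → Fin (n ℕ.* 2)) → (∀ i → toℕ (e i) ≡ k ℕ.* 2 ℕ.+ toℕ i) →
    ops (applyUpTo f r) (factors (suc r) e) ≈ proj₁ (transfer (suc r) (x ∘ e) (y ∘ e))
  ops-factors zero    k f≡ e e≡ = sym (trans
    (+-congˡ (trans (-‿cong (trans (*-congˡ (zeroʳ _)) (zeroʳ ƛ))) -0#≈0#))
    (+-identityʳ _))
  ops-factors (suc r) k {f} f≡ e e≡ = begin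
    1-ƛσ K (ops (applyUpTo (f ∘ suc) r) (f₁ * factors (suc r) e′))
      ≈⟨ 1-ƛσ-cong K (ops-* (factors (suc r) e′) (All.applyUpTo⁺₂ (f ∘ suc) r f₁-fixed)) ⟩
    1-ƛσ K (f₁ * ops (applyUpTo (f ∘ suc) r) (factors (suc r) e′))
      ≈⟨ 1-ƛσ-cong K (*-congˡ (ops-factors r (suc k) f∘suc≡ e′ e′≡)) ⟩
    1-ƛσ K (f₁ * b)
      ≈⟨ +-congˡ (-‿cong (*-congˡ (*-cong σf₁ σb))) ⟩
    f₁ * b - ƛ * ((x (e zero) - x (e (suc zero))) * b′)
      ∎
    where
    K  = 2 ℕ.* f 0
    f₁ = x (e zero) - y (e (suc zero))
    e′ : Fin (suc r ℕ.* 2) → Fin (n ℕ.* 2)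
    e′ i = e (suc (suc i))
    b  = proj₁ (transfer (suc r) (x ∘ e′) (y ∘ e′))
    b′ = proj₂ (transfer (suc r) (x ∘ e′) (y ∘ e′))

    f∘suc≡ : ∀ i → f (suc i) ≡ suc (suc k) ℕ.+ i
    f∘suc≡ i = ≡.trans (f≡ (suc i)) (≡.cong suc (ℕ.+-suc k i))

    e′≡ : ∀ i → toℕ (e′ i) ≡ suc k ℕ.* 2 ℕ.+ toℕ i
    e′≡ i = ≡.trans (e≡ (suc (suc i))) (solve 2 (λ k t →
      k :* con 2 :+ (con 2 :+ t) := con 2 :+ (k :* con 2 :+ t)) ≡.refl k (toℕ i))
      where open +-*-Solver

    -- Counted from zero at the start of the current block, σ with index `2 * f i` moves `y` at
    -- offset `2i + 1` and `x` at offset `2i + 2`.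
    2f≡ : ∀ i → 2 ℕ.* f i ≡ suc (k ℕ.* 2 ℕ.+ suc (2 ℕ.* i))
    2f≡ i = ≡.trans (≡.cong (2 ℕ.*_) (f≡ i)) (solve 2 (λ k i →
      con 2 :* (con 1 :+ (k :+ i)) := con 1 :+ (k :* con 2 :+ (con 1 :+ con 2 :* i))) ≡.refl k i)
      where open +-*-Solver

    offset-≢ : ∀ i {t u} → t ≢ u → toℕ (e i) ≡ k ℕ.* 2 ℕ.+ t → index (e i) ≢ suc (k ℕ.* 2 ℕ.+ u)
    offset-≢ i t≢u eq eq′ = t≢u (ℕ.+-cancelˡ-≡ (k ℕ.* 2) _ _
      (≡.trans (≡.sym eq) (ℕ.suc-injective eq′)))

    x-fixed : ∀ j i → toℕ i ≢ suc (suc (2 ℕ.* j)) → σ (2 ℕ.* f j) (x (e i)) ≈ x (e i)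
    x-fixed j i i≢ = σ-x-fixed (e i) λ eq → offset-≢ i i≢ (e≡ i)
      (≡.trans eq (≡.cong suc (≡.trans (2f≡ j) (≡.sym (ℕ.+-suc (k ℕ.* 2) _)))))

    y-fixed : ∀ j i → toℕ i ≢ suc (2 ℕ.* j) → σ (2 ℕ.* f j) (y (e i)) ≈ y (e i)
    y-fixed j i i≢ = σ-y-fixed (e i) λ eq → offset-≢ i i≢ (e≡ i) (≡.trans eq (2f≡ j))

    f₁-fixed : ∀ j → σ (2 ℕ.* f (suc j)) f₁ ≈ f₁
    f₁-fixed j = +-cong (x-fixed (suc j) zero (λ ()))
      (-‿cong (y-fixed (suc j) (suc zero) (λ eq → ℕ.0≢1+n (ℕ.suc-injective eq))))

    σf₁ : σ K f₁ ≈ x (e zero) - x (e (suc zero))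
    σf₁ = +-cong (x-fixed 0 zero (λ ()))
      (-‿cong (σ-y-moved (e (suc zero)) (≡.trans (≡.cong suc (e≡ (suc zero))) (≡.sym (2f≡ 0)))))

    σb : σ K b ≈ b′
    σb = row-cong
      (σ-x-moved (e′ zero) (≡.cong suc
        (≡.trans (e≡ (suc (suc zero))) (≡.trans (ℕ.+-suc (k ℕ.* 2) 1) (≡.sym (2f≡ 0))))))
      (x-fixed 0 (suc (suc (suc zero))) (λ ()))
      (y-fixed 0 (suc (suc (suc zero))) (λ ()))
      (proj₁ fixed) (proj₂ fixed)
      where
      fixed = transfer-fixed K r
        (λ i → x-fixed 0 (suc (suc (suc (suc i)))) (λ ()))
        (λ i → y-fixed 0 (suc (suc (suc (suc i)))) (λ ()))

-- Comparison of the two matrix products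

∏[1-ƛσ]-transfer : ∀ m → let n = suc m in
  let open ℤ[λ][x,y] n
      open Operators n in
  ∏[1-ƛσ] (factors n id) ≈ proj₁ (Scans.transfer commutativeRing ƛ n x y)
∏[1-ƛσ]-transfer m = Operators.ops-factors (suc m) m 0 (λ _ → ≡.refl) id (λ _ → ≡.refl)

theorem6 : (n : ℕ) → 1 ≤ n →
    let open ℤ[λ][x,y] n in
    Pf commutativeRing ƛ n (λ i j → x i - y j)
    ≈ ∏[1-ƛσ] (∏ commutativeRing (λ (i : Fin n) → x (odd i) - y (even i)))
theorem6 (suc m) _ = ≋-trans (Pf-completions n (λ i j → x i - y j))
  (≋-trans (completions-transfer n x y) (≋-sym (∏[1-ƛσ]-transfer m)))
  where
  n = suc m
  open ℤ[λ][x,y] n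
  open Scans commutativeRing ƛ using (Pf-completions)
  open TransferMatrices commutativeRing _ (Operators.ℤ-hom n) ƛ using (completions-transfer)
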